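{- For all $k$-tuples of partitions $\boldsymbol\lambda,\boldsymbol\mu$, the family $\{\mathcal L^S_{\boldsymbol\lambda/\boldsymbol\mu}(X_n;Y_m;t)\}_{n,m\ge0}$ is supersymmetric in the $X$ and $Y$ variables: each $\mathcal L^S_{\boldsymbol\lambda/\boldsymbol\mu}(X_n;Y_m;t)$ is symmetric in $x_1,\dots,x_n$ and symmetric in $y_1,\dots,y_m$, and for $n,m\ge1$, $\mathcal L^S_{\boldsymbol\lambda/\boldsymbol\mu}(x_1,\dots,x_{n-1},r;y_1,\dots,y_{m-1},-r;t)=\mathcal L^S_{\boldsymbol\lambda/\boldsymbol\mu}(x_1,\dots,x_{n-1};y_1,\dots,y_{m-1};t)$.
   Context: Fix an integer $k\ge1$ (colours $1,\dots,k$) and an indeterminate $t$. For $\mathbf I\in\{0,1\}^k$ let $|\mathbf I|=\sum_cI_c$, and for $\mathbf I,\mathbf J\in\mathbb Z^k$ let $\varphi(\mathbf I,\mathbf J)=\sum_{1\le c<d\le k}I_cJ_d$. A vertex is a unit square whose bottom, left, top, right edges carry labels $\mathbf I,\mathbf J,\mathbf K,\mathbf L\in\{0,1\}^k$; $I_c=1$ means a path of colour $c$ uses that edge (paths move up and right). White weight: $W_x(\mathbf I,\mathbf J,\mathbf K,\mathbf L)=\mathbf 1_{\mathbf I+\mathbf J=\mathbf K+\mathbf L}\prod_c\mathbf 1_{I_c+J_c\ne2}\,x^{|\mathbf L|}t^{\varphi(\mathbf L,\mathbf I+\mathbf J)}$; purple weight: $P_x(\mathbf I,\mathbf J,\mathbf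 K,\mathbf L)=\mathbf 1_{\mathbf I+\mathbf J=\mathbf K+\mathbf L}\prod_c\mathbf 1_{K_c\ge J_c}\,x^{|\mathbf L|}t^{\varphi(\mathbf L,\mathbf K-\mathbf J)}$. For $k$-tuples of partitions $\boldsymbol\lambda,\boldsymbol\mu$, each regarded as having exactly $\ell$ parts ($\ell$ large enough), and variables $X_n,Y_m$, consider the lattice with $n+m$ rows and columns $-\ell,\dots,N$ ($N$ large): rows $1,\dots,n$ from the bottom are white with parameters $x_1,\dots,x_n$, rows $n+1,\dots,n+m$ purple with parameters $y_1,\dots,y_m$; the bottom boundary edge of column $c$ carries colour $a$ iff $c=\mu^{(a)}_j-j$ for some $j$, the top boundary edge carries colour $a$ iff $c=\lambda^{(a)}_j-j$ for some $j$, left/right boundaries empty. $\mathcal L^S_{\boldsymbol\lambda/\boldsymbol\mu}(X_n;Y_m;t)$ is the sum over labellings of internal edges of the product of the vertex weights. -}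

module Defs where

open import Level using (Level)
open import Algebra.Bundles using (CommutativeRing)
open import Data.Bool using (Bool; true; false; if_then_else_; _∧_; _∨_; not)
open import Data.Bool.Properties using () renaming (_≟_ to _≟B_)
open import Data.Nat using (ℕ; zero; suc; _≤_; _≡ᵇ_)
open import Data.Nat using () renaming (_+_ to _+ℕ_; _*_ to _*ℕ_; _∸_ to _∸ℕ_)
open import Data.List using (List; []; _∷_; length; _++_; foldr; concatMap; upTo)
import Data.List as List
open import Data.List.Relation.Unary.All using (All)
open import Data.List.Relation.Unary.Linked using (Linked)
open import Data.Vec using (Vec; []; _∷_; tabulate; lookup; zipWith; toList; replicate)
import Data.Vec as Vec
open import Data.Vec.Properties using (≡-dec)
import Data.Nat.Properties as ℕP
open import Data.Fin using (Fin; toℕ)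
open import Data.Product using (Σ; _×_; proj₁)
open import Relation.Nullary using (does)

Partition : Set
Partition = Σ (List ℕ) (λ ps → Linked (λ a b → b ≤ a) ps × All (λ p → 1 ≤ p) ps)

len : Partition → ℕ
len p = length (proj₁ p)

-- j-th part (1-indexed), padded with zeros beyond the length
part : Partition → ℕ → ℕ
part p j = go (proj₁ p) j
  where
  go : List ℕ → ℕ → ℕ
  go []       _             = 0
  go (x ∷ xs) zero          = 0          -- index 0 is not used
  go (x ∷ xs) (suc zero)    = x
  go (x ∷ xs) (suc (suc j)) = go xs (suc j)

Label : ℕ → Set
Label k = Vec Bool k

b2n : Bool → ℕ
b2n true  = 1
b2n false = 0

toNat : ∀ {k} → Label k → Vec ℕ k
toNat = Vec.map b2n

size : ∀ {k} → Label k → ℕ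
size I = Vec.sum (toNat I)

-- φ(I,J) = Σ_{1≤c<d≤k} I_c J_d   (recursion on the first colour:
-- φ(I,J) = I_1 (J_2+…+J_k) + φ((I_2..I_k),(J_2..J_k)))
φ : ∀ {k} → Vec ℕ k → Vec ℕ k → ℕ
φ []       []       = 0
φ (a ∷ as) (b ∷ bs) = a *ℕ Vec.sum bs +ℕ φ as bs

emptyLabel : ∀ {k} → Label k
emptyLabel = replicate _ false

allLabels : (k : ℕ) → List (Label k)
allLabels zero    = [] ∷ []
allLabels (suc k) = concatMap (λ v → (false ∷ v) ∷ (true ∷ v) ∷ []) (allLabels k)

allRows : (k w : ℕ) → List (Vec (Label k) w)
allRows k zero    = [] ∷ []
allRows k (suc w) = concatMap (λ r → List.map (_∷ r) (allLabels k)) (allRows k w)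

conserve : ∀ {k} → Label k → Label k → Label k → Label k → Bool
conserve I J K L = does (≡-dec ℕP._≟_ (zipWith _+ℕ_ (toNat I) (toNat J))
                                        (zipWith _+ℕ_ (toNat K) (toNat L)))

allB : ∀ {k} → Vec Bool k → Bool
allB = Vec.foldr _ _∧_ true

noDouble : ∀ {k} → Label k → Label k → Bool
noDouble I J = allB (zipWith (λ a b → not (a ∧ b)) I J)

dominates : ∀ {k} → Label k → Label k → Bool
dominates K J = allB (zipWith (λ kc jc → kc ∨ not jc) K J)

labelEq : ∀ {k} → Label k → Label k → Bool
labelEq I J = does (≡-dec _≟B_ I J)

rowEq : ∀ {k w} → Vec (Label k) w → Vec (Label k) w → Bool
rowEq R S = does (≡-dec (≡-dec _≟B_) R S)

module Lattice {c ℓ : Level} (R : CommutativeRing c ℓ) where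
  open CommutativeRing R

  pow : Carrier → ℕ → Carrier
  pow x zero    = 1#
  pow x (suc n) = x * pow x n

  Σ[_] : ∀ {a} {A : Set a} → List A → (A → Carrier) → Carrier
  Σ[ xs ] f = foldr (λ a acc → f a + acc) 0# xs

  -- vertex weight: bottom I, left J, top K, right L
  VertexWeight : ℕ → Set c
  VertexWeight k = Label k → Label k → Label k → Label k → Carrier

  white : ∀ {k} → Carrier → Carrier → VertexWeight k
  white t x I J K L =
    if conserve I J K L ∧ noDouble I J
    then pow x (size L) * pow t (φ (toNat L) (zipWith _+ℕ_ (toNat I) (toNat J)))
    else 0#

  purple : ∀ {k} → Carrier → Carrier → VertexWeight k
  purple t x I J K L =
    if conserve I J K L ∧ dominates K J
    then pow x (size L) * pow t (φ (toNat L) (zipWith _∸ℕ_ (toNat K) (toNat J)))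
    else 0#

  -- One row, read left to right; J is the label of the current left edge.
  -- The leftmost left edge and the rightmost right edge are empty
  -- (boundary); the other horizontal edges are summed over.
  rowZ : ∀ {k w} → VertexWeight k → Label k → Vec (Label k) w → Vec (Label k) w → Carrier
  rowZ {k} wt J []       []       = if labelEq J emptyLabel then 1# else 0#
  rowZ {k} wt J (I ∷ Is) (K ∷ Ks) = Σ[ allLabels k ] (λ L → wt I J K L * rowZ wt L Is Ks)

  -- Rows listed bottom to top; sum over labellings of the internal
  -- horizontal rows of vertical edges.
  latZ : ∀ {k w} → List (VertexWeight k) → Vec (Label k) w → Vec (Label k) w → Carrier
  latZ         []         B T = if rowEq B T then 1# else 0#
  latZ {k} {w} (wt ∷ wts) B T = Σ[ allRows k w ] (λ M → rowZ wt emptyLabel B M * latZ wts M T)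

  -- Boundary from a k-tuple of partitions regarded as having exactly ℓ' parts,
  -- on columns -ℓ',…,N; column index i ∈ {0..ℓ'+N} stands for column i - ℓ'.
  -- Colour a is on column i - ℓ' iff  λ^{(a)}_j - j = i - ℓ'  for some 1 ≤ j ≤ ℓ',
  -- i.e. λ^{(a)}_j + ℓ' = j + i.
  boundary : ∀ {k} → Vec Partition k → (ℓ' N : ℕ) → Vec (Label k) (suc (ℓ' +ℕ N))
  boundary {k} lam ℓ' N =
    tabulate (λ (i : Fin (suc (ℓ' +ℕ N))) → tabulate (λ (a : Fin k) →
      List.foldr _∨_ false
        (List.map (λ j → (part (lookup lam a) (suc j) +ℕ ℓ') ≡ᵇ (suc j +ℕ toℕ i)) (upTo ℓ'))))

  LS : ∀ {k n m} → Carrier → (lam mu : Vec Partition k) → (ℓ' N : ℕ)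
     → Vec Carrier n → Vec Carrier m → Carrier
  LS t lam mu ℓ' N xs ys =
    latZ (toList (Vec.map (white t) xs) ++ toList (Vec.map (purple t) ys))
         (boundary mu ℓ' N) (boundary lam ℓ' N)

{-# OPTIONS --safe #-}

-- A white row W(x) followed by a purple row P(y) can be fused into a single row
-- of vertices whose horizontal labels S record the union of the colours on the
-- two horizontal edges: sum the pairs A + B = S with the weights
-- x^|A| y^|B| t^φ(A,S). The rows in the other order also fuse, now without
-- weights, because the partition function to the right of a column depends on A
-- and B only through A + B. Up to the factor ∏_{i<|S|} (x t^i + y) the two fused
-- vertices agree, so W(x) P(y) = P(y) W(x); if y = - x this factor vanishes
-- unless S is empty, so W(x) P(- x) = 1. Hence P(- x) is the two-sided inverse of
-- W(x), and the W(x) commute with each other because each W(x') commutes with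
-- the inverse of W(x); similarly for the P(y).
module Submission where

open import Defs
open import Algebra.Bundles using (CommutativeRing)
open import Data.Bool using (Bool; true; false; if_then_else_; _∧_)
open import Data.Fin as Fin using (Fin; punchIn)
open import Data.Fin.Permutation using (Permutation′; _⟨$⟩ʳ_; remove; punchIn-permute)
open import Data.List using (List; []; _∷_; _++_; concatMap)
import Data.List as List
open import Data.List.Properties using (map-++; ++-assoc)
open import Data.List.Relation.Binary.Permutation.Propositional
  using (_↭_; prep; ↭-trans; ↭-reflexive)
open import Data.List.Relation.Binary.Permutation.Propositional.Properties using (++-comm)
open import Data.Nat using (ℕ; zero; suc; _≤_; _∸_)
import Data.Nat as ℕ
import Data.Nat.Properties as ℕ
open import Data.Nat.Tactic.RingSolver using (solve-∀)
open import Data.Product using (_×_; _,_)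
open import Data.Sum using (_⊎_; inj₁; inj₂)
open import Data.Vec using (Vec; []; _∷_; lookup; tabulate; _∷ʳ_; zipWith; toList)
import Data.Vec as Vec
open import Data.Vec.Properties
  using (≡-dec; tabulate-cong; tabulate∘lookup; toList-∷ʳ; toList-map)
open import Level using (_⊔_)
open import Relation.Binary.PropositionalEquality as ≡ using (_≡_)
open import Relation.Nullary using (yes; no)

-- The obstacle is that φ couples the colours. A colour on the right edge of the white vertex
-- carries t to the number |I| + |A| of later colours entering it, and A is summed over, so the
-- local relations do not simply factor over colours. Path conservation repairs this: in the
-- white-purple order |I| + |A| = |A'| + |B'| + e, where e counts the later colours in K but not in
-- B, and e is also the exponent at the purple vertex. So each colour on the fused right edge
-- contributes t^e times a factor fixed by the outgoing labels. After j such colours the remaining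
-- ones are summed with an extra weight t^(je). With this weight in the statement, induction over
-- the colours closes, and each step is a polynomial identity for one colour. The other order is
-- similar, with e taken between M and B and the incoming labels fixed. The factors x t^i + y count
-- routes. A colour can run along either of two horizontal edges, and the two contributions add up
-- when it leaves the fused edge in the weighted order, or when it enters that edge in the
-- unweighted one.

-- Permutations of vectors and lists

module _ {a} {A : Set a} where

  tabulate-punchIn : ∀ {n} (f : Fin (suc n) → A) j →
    f j ∷ toList (tabulate (λ i → f (punchIn j i))) ↭ toList (tabulate f)
  tabulate-punchIn f Fin.zero = _↭_.refl
  tabulate-punchIn {suc n} f (Fin.suc j) = _↭_.trans (_↭_.swap _ _ _↭_.refl)
    (prep _ (tabulate-punchIn (λ i → f (Fin.suc i)) j))

  -- The entry that σ selects first is moved to the front; `remove Fin.zero σ` permutes the others,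
  -- which are indexed through `punchIn`.
  tabulate-permute : ∀ {n} (f : Fin n → A) (σ : Permutation′ n) →
    toList (tabulate (λ i → f (σ ⟨$⟩ʳ i))) ↭ toList (tabulate f)
  tabulate-permute {zero}  f σ = _↭_.refl
  tabulate-permute {suc n} f σ = _↭_.trans
    (prep _ (↭-trans (↭-reflexive (≡.cong toList (tabulate-cong λ i →
        ≡.cong f (punchIn-permute σ Fin.zero i))))
      (tabulate-permute (λ i → f (punchIn (σ ⟨$⟩ʳ Fin.zero) i)) (remove Fin.zero σ))))
    (tabulate-punchIn f (σ ⟨$⟩ʳ Fin.zero))

  toList-permute : ∀ {n} (xs : Vec A n) (σ : Permutation′ n) →
    toList (tabulate (λ i → lookup xs (σ ⟨$⟩ʳ i))) ↭ toList xs
  toList-permute xs σ = ↭-trans (tabulate-permute (lookup xs) σ)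
    (↭-reflexive (≡.cong toList (tabulate∘lookup xs)))

  -- Brings the last purple parameter to the bottom of the purple block, next to the last white row.
  toList-∷ʳ-↭ : ∀ {n} (xs : Vec A n) x → toList (xs ∷ʳ x) ↭ x ∷ toList xs
  toList-∷ʳ-↭ xs x = ↭-trans (↭-reflexive (toList-∷ʳ x xs)) (++-comm (toList xs) (x ∷ []))

-- Sizes of labels

-- Truncated subtraction as in `purple`, so that the exponent which φ assigns to a new first colour
-- is an `excess` by computation.
excess : ∀ {k} → Label k → Label k → ℕ
excess K J = Vec.sum (zipWith _∸_ (toNat K) (toNat J))

sum-zipWith-+ : ∀ {k} (u v : Vec ℕ k) →
                Vec.sum (zipWith ℕ._+_ u v) ≡ Vec.sum u ℕ.+ Vec.sum v
sum-zipWith-+ []      []      = ≡.refl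
sum-zipWith-+ (a ∷ u) (b ∷ v) =
  ≡.trans (≡.cong (a ℕ.+ b ℕ.+_) (sum-zipWith-+ u v)) (lemma a b (Vec.sum u) (Vec.sum v))
  where
  lemma : ∀ a b c d → a ℕ.+ b ℕ.+ (c ℕ.+ d) ≡ a ℕ.+ c ℕ.+ (b ℕ.+ d)
  lemma = solve-∀

dominates-size : ∀ {k} (K J : Label k) → dominates K J ≡ true →
                 size K ≡ excess K J ℕ.+ size J
dominates-size []          []          _ = ≡.refl
dominates-size (false ∷ K) (false ∷ J) d = dominates-size K J d
dominates-size (true  ∷ K) (false ∷ J) d = ≡.cong suc (dominates-size K J d)
dominates-size (true  ∷ K) (true  ∷ J) d =
  ≡.trans (≡.cong suc (dominates-size K J d)) (≡.sym (ℕ.+-suc _ _))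

-- The factors by which one colour multiplies the weights of the remaining
-- colours. They are polymorphic in the scalars so that each identity between
-- them is also an identity of solver polynomials.
module OneColour {a} {A : Set a} (𝟘 𝟙 : A) (_⊕_ _⊗_ : A → A → A) where

  white₁ : (i j k l : Bool) → A → A
  white₁ false false false false z = 𝟙
  white₁ true  false true  false z = 𝟙
  white₁ true  false false true  z = z
  white₁ false true  true  false z = 𝟙
  white₁ false true  false true  z = z
  white₁ _     _     _     _     z = 𝟘

  purple₁ : (i j k l : Bool) → A → A
  purple₁ false false false false z = 𝟙
  purple₁ true  false true  false z = 𝟙
  purple₁ true  false false true  z = z
  purple₁ false true  true  false z = 𝟙
  purple₁ true  true  true  true  z = z
  purple₁ _     _     _     _     z = 𝟘

  glue₁ : (s a b : Bool) → A → A → A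
  glue₁ false false false p q = 𝟙
  glue₁ true  true  false p q = p
  glue₁ true  false true  p q = q
  glue₁ _     _     _     p q = 𝟘

  -- The colour joins the horizontal edge from below with weight `enter` and quits it at the top
  -- with weight `leave`. The two orders of rows differ only in these two weights.
  fused₁ : (enter leave : A) (i s k s' : Bool) (p q T : A) → A
  fused₁ enter leave false false false false p q T = 𝟙
  fused₁ enter leave true  false true  false p q T = T
  fused₁ enter leave true  false false true  p q T = enter
  fused₁ enter leave false true  false true  p q T = p
  fused₁ enter leave true  true  true  true  p q T = q
  fused₁ enter leave false true  true  false p q T = leave
  fused₁ enter leave _     _     _     _     p q T = 𝟘

  fusedWP₁ fusedPW₁ : (i s k s' : Bool) (p q T : A) → A
  fusedWP₁ i s k s' p q T = fused₁ 𝟙 ((p ⊗ T) ⊕ q) i s k s' p q T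
  fusedPW₁ i s k s' p q T = fused₁ ((p ⊗ T) ⊕ q) 𝟙 i s k s' p q T

  excess₁ : (k b : Bool) → A → A
  excess₁ true false T = T
  excess₁ _    _     T = 𝟙

  scale₁ : Bool → A → A
  scale₁ true  z = z
  scale₁ false z = 𝟙

  sum₁ : (Bool → A) → A
  sum₁ f = f false ⊕ f true

  sum₃ : (Bool → Bool → Bool → A) → A
  sum₃ f = sum₁ (λ a → sum₁ (λ b → sum₁ (λ m → f a b m)))

  wpTerm : (i s k a' b' : Bool) (p q T z₁ z₂ : A) (a b m : Bool) → A
  wpTerm i s k a' b' p q T z₁ z₂ a b m =
    excess₁ k b T ⊗ (glue₁ s a b p q ⊗ (white₁ i a m a' z₁ ⊗ purple₁ m b k b' z₂))

  -- `Z` stands for t to the excess of the later colours, and `X` for x times the power of t fixed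
  -- by the outgoing labels. Path conservation makes `X ⊗ Z` the white parameter, so white and
  -- purple share the factor `Z`.
  wpSum wpFused : (i s k a' b' : Bool) (p q T X Z : A) → A
  wpSum i s k a' b' p q T X Z = sum₃ (wpTerm i s k a' b' p q T (X ⊗ Z) (q ⊗ Z))
  wpFused i s k a' b' p q T X Z =
    sum₁ (λ s' → (fusedWP₁ i s k s' p q T ⊗ glue₁ s' a' b' X q) ⊗ scale₁ s' Z)

  pwTerm : (i k a b s' : Bool) (T z₁ z₂ : A) (a' b' m : Bool) → A
  pwTerm i k a b s' T z₁ z₂ a' b' m =
    excess₁ m b T ⊗ ((purple₁ i b m b' z₂ ⊗ white₁ m a k a' z₁) ⊗ glue₁ s' a' b' 𝟙 𝟙)

  pwSum pwFused : (i k a b s' : Bool) (q T X Z : A) → A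
  pwSum i k a b s' q T X Z = sum₃ (pwTerm i k a b s' T (X ⊗ Z) (q ⊗ Z))
  pwFused i k a b s' q T X Z =
    sum₁ (λ s → glue₁ s a b 𝟙 𝟙 ⊗ fusedPW₁ i s k s' X q T) ⊗ scale₁ s' Z

module TransferMatrices {c ℓ} (R : CommutativeRing c ℓ) where
  open CommutativeRing R hiding (zero)
  open Lattice R
  open OneColour 0# 1# _+_ _*_
  open import Relation.Binary.Reasoning.Setoid setoid
  open import Algebra.Solver.Ring.NaturalCoefficients.Default commutativeSemiring
    using (solve; _:=_; _:+_; _:*_; con; Polynomial)

  -- Finite sums

  module _ {a} {A : Set a} where

    Σ-cong : (xs : List A) {f g : A → Carrier} → (∀ a → f a ≈ g a) → Σ[ xs ] f ≈ Σ[ xs ] g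
    Σ-cong []       eq = refl
    Σ-cong (x ∷ xs) eq = +-cong (eq x) (Σ-cong xs eq)

    Σ-+ : (xs : List A) (f g : A → Carrier) →
          Σ[ xs ] (λ a → f a + g a) ≈ Σ[ xs ] f + Σ[ xs ] g
    Σ-+ []       f g = sym (+-identityˡ 0#)
    Σ-+ (x ∷ xs) f g = trans (+-congˡ (Σ-+ xs f g))
      (solve 4 (λ a b c d → (a :+ b) :+ (c :+ d) := (a :+ c) :+ (b :+ d)) refl _ _ _ _)

    Σ-*ˡ : (xs : List A) (c : Carrier) (f : A → Carrier) →
           Σ[ xs ] (λ a → c * f a) ≈ c * Σ[ xs ] f
    Σ-*ˡ []       c f = sym (zeroʳ c)
    Σ-*ˡ (x ∷ xs) c f = trans (+-congˡ (Σ-*ˡ xs c f)) (sym (distribˡ c _ _))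

    Σ-*ʳ : (xs : List A) (c : Carrier) (f : A → Carrier) →
           Σ[ xs ] (λ a → f a * c) ≈ Σ[ xs ] f * c
    Σ-*ʳ xs c f = trans (Σ-cong xs (λ a → *-comm (f a) c)) (trans (Σ-*ˡ xs c f) (*-comm c _))

    Σ-0 : (xs : List A) → Σ[ xs ] (λ _ → 0#) ≈ 0#
    Σ-0 []       = refl
    Σ-0 (x ∷ xs) = trans (+-identityˡ _) (Σ-0 xs)

    Σ-++ : (xs ys : List A) (f : A → Carrier) → Σ[ xs ++ ys ] f ≈ Σ[ xs ] f + Σ[ ys ] f
    Σ-++ []       ys f = sym (+-identityˡ _)
    Σ-++ (x ∷ xs) ys f = trans (+-congˡ (Σ-++ xs ys f)) (sym (+-assoc _ _ _))

  module _ {a b} {A : Set a} {B : Set b} where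

    Σ-swap : (xs : List A) (ys : List B) (f : A → B → Carrier) →
             Σ[ xs ] (λ a → Σ[ ys ] (f a)) ≈ Σ[ ys ] (λ b → Σ[ xs ] (λ a → f a b))
    Σ-swap []       ys f = sym (Σ-0 ys)
    Σ-swap (x ∷ xs) ys f = trans (+-congˡ (Σ-swap xs ys f)) (sym (Σ-+ ys (f x) _))

    Σ-map : (xs : List A) (h : A → B) (f : B → Carrier) →
            Σ[ List.map h xs ] f ≈ Σ[ xs ] (λ a → f (h a))
    Σ-map []       h f = refl
    Σ-map (x ∷ xs) h f = +-congˡ (Σ-map xs h f)

    Σ-concatMap : (xs : List A) (h : A → List B) (f : B → Carrier) →
                  Σ[ concatMap h xs ] f ≈ Σ[ xs ] (λ a → Σ[ h a ] f)
    Σ-concatMap []       h f = refl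
    Σ-concatMap (x ∷ xs) h f = trans (Σ-++ (h x) _ f) (+-congˡ (Σ-concatMap xs h f))

    Σ-*-Σ : (xs : List A) (ys : List B) (f : A → Carrier) (g : B → Carrier) →
            Σ[ xs ] f * Σ[ ys ] g ≈ Σ[ xs ] (λ a → Σ[ ys ] (λ b → f a * g b))
    Σ-*-Σ xs ys f g = trans (sym (Σ-*ʳ xs _ f)) (Σ-cong xs (λ a → sym (Σ-*ˡ ys (f a) g)))

  -- Opaque, so that unification can read off implicit lengths and summands.
  opaque

    ΣL : ∀ {k} → (Label k → Carrier) → Carrier
    ΣL {k} f = Σ[ allLabels k ] f

    ΣL-def : ∀ {k} (f : Label k → Carrier) → Σ[ allLabels k ] f ≡ ΣL f
    ΣL-def f = ≡.refl

    ΣL-cong : ∀ {k} {f g : Label k → Carrier} → (∀ L → f L ≈ g L) → ΣL f ≈ ΣL g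
    ΣL-cong {k} = Σ-cong (allLabels k)

    ΣL-[] : (f : Label 0 → Carrier) → ΣL f ≈ f []
    ΣL-[] f = +-identityʳ _

    ΣL-suc : ∀ {k} (f : Label (suc k) → Carrier) →
             ΣL f ≈ ΣL (λ L → f (false ∷ L) + f (true ∷ L))
    ΣL-suc {k} f = trans (Σ-concatMap (allLabels k) _ f)
      (Σ-cong (allLabels k) (λ L → +-congˡ (+-identityʳ _)))

    ΣL-swap : ∀ {k k'} (f : Label k → Label k' → Carrier) →
              ΣL (λ A → ΣL (f A)) ≈ ΣL (λ B → ΣL (λ A → f A B))
    ΣL-swap {k} {k'} = Σ-swap (allLabels k) (allLabels k')

    ΣL-+ : ∀ {k} (f g : Label k → Carrier) → ΣL (λ L → f L + g L) ≈ ΣL f + ΣL g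
    ΣL-+ {k} = Σ-+ (allLabels k)

    ΣL-*ˡ : ∀ {k} (c : Carrier) (f : Label k → Carrier) → ΣL (λ L → c * f L) ≈ c * ΣL f
    ΣL-*ˡ {k} = Σ-*ˡ (allLabels k)

    ΣL-*ʳ : ∀ {k} (c : Carrier) (f : Label k → Carrier) → ΣL (λ L → f L * c) ≈ ΣL f * c
    ΣL-*ʳ {k} = Σ-*ʳ (allLabels k)

    ΣL-*-ΣL : ∀ {k k'} (f : Label k → Carrier) (g : Label k' → Carrier) →
              ΣL f * ΣL g ≈ ΣL (λ A → ΣL (λ B → f A * g B))
    ΣL-*-ΣL {k} {k'} = Σ-*-Σ (allLabels k) (allLabels k')

    ΣR : ∀ {k w} → (Vec (Label k) w → Carrier) → Carrier
    ΣR {k} {w} f = Σ[ allRows k w ] f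

    ΣR-def : ∀ {k w} (f : Vec (Label k) w → Carrier) → Σ[ allRows k w ] f ≡ ΣR f
    ΣR-def f = ≡.refl

    ΣR-cong : ∀ {k w} {f g : Vec (Label k) w → Carrier} → (∀ M → f M ≈ g M) → ΣR f ≈ ΣR g
    ΣR-cong {k} {w} = Σ-cong (allRows k w)

    ΣR-[] : ∀ {k} (f : Vec (Label k) 0 → Carrier) → ΣR f ≈ f []
    ΣR-[] f = +-identityʳ _

    ΣR-suc : ∀ {k w} (f : Vec (Label k) (suc w) → Carrier) →
             ΣR f ≈ ΣR (λ r → ΣL (λ L → f (L ∷ r)))
    ΣR-suc {k} {w} f = trans (Σ-concatMap (allRows k w) _ f)
      (Σ-cong (allRows k w) (λ r → Σ-map (allLabels k) (_∷ r) f))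

    ΣR-swap : ∀ {k w k' w'} (f : Vec (Label k) w → Vec (Label k') w' → Carrier) →
              ΣR (λ A → ΣR (f A)) ≈ ΣR (λ B → ΣR (λ A → f A B))
    ΣR-swap {k} {w} {k'} {w'} = Σ-swap (allRows k w) (allRows k' w')

    ΣR-*ˡ : ∀ {k w} (c : Carrier) (f : Vec (Label k) w → Carrier) →
            ΣR (λ M → c * f M) ≈ c * ΣR f
    ΣR-*ˡ {k} {w} = Σ-*ˡ (allRows k w)

    ΣR-*ʳ : ∀ {k w} (c : Carrier) (f : Vec (Label k) w → Carrier) →
            ΣR (λ M → f M * c) ≈ ΣR f * c
    ΣR-*ʳ {k} {w} = Σ-*ʳ (allRows k w)

    ΣR-ΣL : ∀ {k w k'} (f : Vec (Label k) w → Label k' → Carrier) →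
            ΣR (λ M → ΣL (f M)) ≈ ΣL (λ L → ΣR (λ M → f M L))
    ΣR-ΣL {k} {w} {k'} = Σ-swap (allRows k w) (allLabels k')

  -- Kronecker deltas

  [_] : Bool → Carrier
  [ b ] = if b then 1# else 0#

  []-∧ : ∀ a b → [ a ∧ b ] ≈ [ a ] * [ b ]
  []-∧ true  b = sym (*-identityˡ _)
  []-∧ false b = sym (zeroˡ _)

  ΣL-δ : ∀ {k} (B : Label k) (f : Label k → Carrier) → ΣL (λ A → [ labelEq A B ] * f A) ≈ f B
  ΣL-δ []      f = trans (ΣL-[] _) (*-identityˡ _)
  ΣL-δ (false ∷ B) f = trans (ΣL-suc _) (trans
    (ΣL-cong (λ A → trans (+-congˡ (zeroˡ _)) (+-identityʳ _))) (ΣL-δ B (λ A → f (false ∷ A))))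
  ΣL-δ (true ∷ B) f = trans (ΣL-suc _) (trans
    (ΣL-cong (λ A → trans (+-congʳ (zeroˡ _)) (+-identityˡ _))) (ΣL-δ B (λ A → f (true ∷ A))))

  labelEq-sym : ∀ {k} (A B : Label k) → labelEq A B ≡ labelEq B A
  labelEq-sym []          []          = ≡.refl
  labelEq-sym (false ∷ A) (false ∷ B) = labelEq-sym A B
  labelEq-sym (false ∷ A) (true  ∷ B) = ≡.refl
  labelEq-sym (true  ∷ A) (false ∷ B) = ≡.refl
  labelEq-sym (true  ∷ A) (true  ∷ B) = labelEq-sym A B

  ΣR-δ : ∀ {k w} (B : Vec (Label k) w) (f : Vec (Label k) w → Carrier) →
         ΣR (λ M → [ rowEq B M ] * f M) ≈ f B
  ΣR-δ []       f = trans (ΣR-[] _) (*-identityˡ _)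
  ΣR-δ (I ∷ Is) f = begin
    ΣR (λ M → [ rowEq (I ∷ Is) M ] * f M)
      ≈⟨ ΣR-suc _ ⟩
    ΣR (λ r → ΣL (λ L → [ labelEq I L ∧ rowEq Is r ] * f (L ∷ r)))
      ≈⟨ ΣR-cong (λ r → trans
           (ΣL-cong (λ L → trans
              (*-congʳ (trans ([]-∧ (labelEq I L) (rowEq Is r))
                 (*-congʳ (reflexive (≡.cong [_] (labelEq-sym I L))))))
              (solve 3 (λ x y z → (x :* y) :* z := y :* (x :* z)) refl _ _ _)))
           (trans (ΣL-*ˡ _ _) (*-congˡ (ΣL-δ I _)))) ⟩
    ΣR (λ r → [ rowEq Is r ] * f (I ∷ r))
      ≈⟨ ΣR-δ Is _ ⟩
    f (I ∷ Is) ∎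

  -- Vertex weights, one colour at a time

  module Syntactic {n} = OneColour {A = Polynomial n} (con 0) (con 1) _:+_ _:*_

  wpEquation : Bool → Bool → Bool → Bool → Bool → (p q T X Z : Polynomial 5) →
               Polynomial 5 × Polynomial 5
  wpEquation i s k a' b' p q T X Z =
    Syntactic.wpSum i s k a' b' p q T X Z := Syntactic.wpFused i s k a' b' p q T X Z

  -- Once the five bits are fixed, every factor computes and a semiring identity remains. The
  -- outgoing a' and b' are never both occupied: a' forces the middle edge to be empty, b' forces it
  -- to be occupied. This agrees with the exclusion in `glue₁`.
  wp₁ : ∀ i s k a' b' p q T X Z →
        wpSum i s k a' b' p q T X Z ≈ wpFused i s k a' b' p q T X Z
  wp₁ false false false false false = solve 5 (wpEquation false false false false false) refl
  wp₁ false false false false true  = solve 5 (wpEquation false false false false true) refl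
  wp₁ false false false true  false = solve 5 (wpEquation false false false true false) refl
  wp₁ false false false true  true  = solve 5 (wpEquation false false false true true) refl
  wp₁ false false true  false false = solve 5 (wpEquation false false true false false) refl
  wp₁ false false true  false true  = solve 5 (wpEquation false false true false true) refl
  wp₁ false false true  true  false = solve 5 (wpEquation false false true true false) refl
  wp₁ false false true  true  true  = solve 5 (wpEquation false false true true true) refl
  wp₁ false true  false false false = solve 5 (wpEquation false true false false false) refl
  wp₁ false true  false false true  = solve 5 (wpEquation false true false false true) refl
  wp₁ false true  false true  false = solve 5 (wpEquation false true false true false) refl
  wp₁ false true  false true  true  = solve 5 (wpEquation false true false true true) refl
  wp₁ false true  true  false false = solve 5 (wpEquation false true true false false) refl
  wp₁ false true  true  false true  = solve 5 (wpEquation false true true false true) refl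
  wp₁ false true  true  true  false = solve 5 (wpEquation false true true true false) refl
  wp₁ false true  true  true  true  = solve 5 (wpEquation false true true true true) refl
  wp₁ true  false false false false = solve 5 (wpEquation true false false false false) refl
  wp₁ true  false false false true  = solve 5 (wpEquation true false false false true) refl
  wp₁ true  false false true  false = solve 5 (wpEquation true false false true false) refl
  wp₁ true  false false true  true  = solve 5 (wpEquation true false false true true) refl
  wp₁ true  false true  false false = solve 5 (wpEquation true false true false false) refl
  wp₁ true  false true  false true  = solve 5 (wpEquation true false true false true) refl
  wp₁ true  false true  true  false = solve 5 (wpEquation true false true true false) refl
  wp₁ true  false true  true  true  = solve 5 (wpEquation true false true true true) refl
  wp₁ true  true  false false false = solve 5 (wpEquation true true false false false) refl
  wp₁ true  true  false false true  = solve 5 (wpEquation true true false false true) refl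
  wp₁ true  true  false true  false = solve 5 (wpEquation true true false true false) refl
  wp₁ true  true  false true  true  = solve 5 (wpEquation true true false true true) refl
  wp₁ true  true  true  false false = solve 5 (wpEquation true true true false false) refl
  wp₁ true  true  true  false true  = solve 5 (wpEquation true true true false true) refl
  wp₁ true  true  true  true  false = solve 5 (wpEquation true true true true false) refl
  wp₁ true  true  true  true  true  = solve 5 (wpEquation true true true true true) refl

  pwEquation : Bool → Bool → Bool → Bool → Bool → (q T X Z : Polynomial 4) →
               Polynomial 4 × Polynomial 4
  pwEquation i k a b s' q T X Z =
    Syntactic.pwSum i k a b s' q T X Z := Syntactic.pwFused i k a b s' q T X Z

  -- Here the incoming a and b exclude each other: b forces the middle edge to be occupied, and a
  -- white vertex does not admit the same colour from below and from the left.
  pw₁ : ∀ i k a b s' q T X Z → pwSum i k a b s' q T X Z ≈ pwFused i k a b s' q T X Z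
  pw₁ false false false false false = solve 4 (pwEquation false false false false false) refl
  pw₁ false false false false true  = solve 4 (pwEquation false false false false true) refl
  pw₁ false false false true  false = solve 4 (pwEquation false false false true false) refl
  pw₁ false false false true  true  = solve 4 (pwEquation false false false true true) refl
  pw₁ false false true  false false = solve 4 (pwEquation false false true false false) refl
  pw₁ false false true  false true  = solve 4 (pwEquation false false true false true) refl
  pw₁ false false true  true  false = solve 4 (pwEquation false false true true false) refl
  pw₁ false false true  true  true  = solve 4 (pwEquation false false true true true) refl
  pw₁ false true  false false false = solve 4 (pwEquation false true false false false) refl
  pw₁ false true  false false true  = solve 4 (pwEquation false true false false true) refl
  pw₁ false true  false true  false = solve 4 (pwEquation false true false true false) refl
  pw₁ false true  false true  true  = solve 4 (pwEquation false true false true true) refl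
  pw₁ false true  true  false false = solve 4 (pwEquation false true true false false) refl
  pw₁ false true  true  false true  = solve 4 (pwEquation false true true false true) refl
  pw₁ false true  true  true  false = solve 4 (pwEquation false true true true false) refl
  pw₁ false true  true  true  true  = solve 4 (pwEquation false true true true true) refl
  pw₁ true  false false false false = solve 4 (pwEquation true false false false false) refl
  pw₁ true  false false false true  = solve 4 (pwEquation true false false false true) refl
  pw₁ true  false false true  false = solve 4 (pwEquation true false false true false) refl
  pw₁ true  false false true  true  = solve 4 (pwEquation true false false true true) refl
  pw₁ true  false true  false false = solve 4 (pwEquation true false true false false) refl
  pw₁ true  false true  false true  = solve 4 (pwEquation true false true false true) refl
  pw₁ true  false true  true  false = solve 4 (pwEquation true false true true false) refl
  pw₁ true  false true  true  true  = solve 4 (pwEquation true false true true true) refl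
  pw₁ true  true  false false false = solve 4 (pwEquation true true false false false) refl
  pw₁ true  true  false false true  = solve 4 (pwEquation true true false false true) refl
  pw₁ true  true  false true  false = solve 4 (pwEquation true true false true false) refl
  pw₁ true  true  false true  true  = solve 4 (pwEquation true true false true true) refl
  pw₁ true  true  true  false false = solve 4 (pwEquation true true true false false) refl
  pw₁ true  true  true  false true  = solve 4 (pwEquation true true true false true) refl
  pw₁ true  true  true  true  false = solve 4 (pwEquation true true true true false) refl
  pw₁ true  true  true  true  true  = solve 4 (pwEquation true true true true true) refl

  pow-+ : ∀ t m n → pow t (m ℕ.+ n) ≈ pow t m * pow t n
  pow-+ t zero    n = sym (*-identityˡ _)
  pow-+ t (suc m) n = trans (*-congˡ (pow-+ t m n)) (sym (*-assoc _ _ _))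

  pow-* : ∀ s t n → pow (s * t) n ≈ pow s n * pow t n
  pow-* s t zero    = sym (*-identityˡ _)
  pow-* s t (suc n) = trans (*-congˡ (pow-* s t n))
    (solve 4 (λ a b c d → (a :* b) :* (c :* d) := (a :* c) :* (b :* d)) refl _ _ _ _)

  pow-1 : ∀ n → pow 1# n ≈ 1#
  pow-1 zero    = refl
  pow-1 (suc n) = trans (*-identityˡ _) (pow-1 n)

  -- A new first colour on the right edge is paired by φ with all later entries, whose total is s;
  -- hence the factor x t^s.
  monomial-∷ : ∀ x t b p s s' e → s ≡ s' →
               (if b then (x * p) * pow t (1 ℕ.* s ℕ.+ e) else 0#) ≈
               (x * pow t s') * (if b then p * pow t e else 0#)
  monomial-∷ x t false p s s' e eq = sym (zeroʳ _)
  monomial-∷ x t true p s .s e ≡.refl = trans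
    (*-congˡ (trans (reflexive (≡.cong (λ n → pow t (n ℕ.+ e)) (ℕ.*-identityˡ s))) (pow-+ t s e)))
    (solve 4 (λ a b c d → (a :* b) :* (c :* d) := (a :* c) :* (b :* d)) refl _ _ _ _)

  if-∧-false : ∀ b {v z} → (if b ∧ false then v else 0#) ≈ 0# * z
  if-∧-false false = sym (zeroˡ _)
  if-∧-false true  = sym (zeroˡ _)

  white-∷ : ∀ {k} t x i j m l (I J M L : Label k) →
            white t x (i ∷ I) (j ∷ J) (m ∷ M) (l ∷ L) ≈
            white₁ i j m l (x * pow t (size I ℕ.+ size J)) * white t x I J M L
  white-∷ t x i j m l I J M L = go i j m l
    where
    right : _
    right = monomial-∷ x t (conserve I J M L ∧ noDouble I J) (pow x (size L)) _ _
              (φ (toNat L) (zipWith ℕ._+_ (toNat I) (toNat J)))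
              (sum-zipWith-+ (toNat I) (toNat J))
    go : ∀ i j m l → white t x (i ∷ I) (j ∷ J) (m ∷ M) (l ∷ L) ≈
         white₁ i j m l (x * pow t (size I ℕ.+ size J)) * white t x I J M L
    go false false false false = sym (*-identityˡ _)
    go false false false true  = sym (zeroˡ _)
    go false false true  false = sym (zeroˡ _)
    go false false true  true  = sym (zeroˡ _)
    go false true  false false = sym (zeroˡ _)
    go false true  false true  = right
    go false true  true  false = sym (*-identityˡ _)
    go false true  true  true  = sym (zeroˡ _)
    go true  false false false = sym (zeroˡ _)
    go true  false false true  = right
    go true  false true  false = sym (*-identityˡ _)
    go true  false true  true  = sym (zeroˡ _)
    go true  true  false false = sym (zeroˡ _)
    go true  true  false true  = sym (zeroˡ _)
    go true  true  true  false = sym (zeroˡ _)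
    -- This configuration conserves the colour; only the exclusion guard, second in the conjunction,
    -- removes it.
    go true  true  true  true  = if-∧-false (conserve I J M L)

  purple-∷ : ∀ {k} t y i j m l (I J M L : Label k) →
             purple t y (i ∷ I) (j ∷ J) (m ∷ M) (l ∷ L) ≈
             purple₁ i j m l (y * pow t (excess M J)) * purple t y I J M L
  purple-∷ t y i j m l I J M L = go i j m l
    where
    right : _
    right = monomial-∷ y t (conserve I J M L ∧ dominates M J) (pow y (size L)) (excess M J) _
              (φ (toNat L) (zipWith _∸_ (toNat M) (toNat J))) ≡.refl
    go : ∀ i j m l → purple t y (i ∷ I) (j ∷ J) (m ∷ M) (l ∷ L) ≈
         purple₁ i j m l (y * pow t (excess M J)) * purple t y I J M L
    go false false false false = sym (*-identityˡ _)
    go false false false true  = sym (zeroˡ _)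
    go false false true  false = sym (zeroˡ _)
    go false false true  true  = sym (zeroˡ _)
    go false true  false false = sym (zeroˡ _)
    -- The horizontal path conserves the colour but violates K ≥ J.
    go false true  false true  = if-∧-false (conserve I J M L)
    go false true  true  false = sym (*-identityˡ _)
    go false true  true  true  = sym (zeroˡ _)
    go true  false false false = sym (zeroˡ _)
    go true  false false true  = right
    go true  false true  false = sym (*-identityˡ _)
    go true  false true  true  = sym (zeroˡ _)
    go true  true  false false = sym (zeroˡ _)
    go true  true  false true  = sym (zeroˡ _)
    go true  true  true  false = sym (zeroˡ _)
    go true  true  true  true  = right

  -- Supports of the vertex weights

  conserve-size : ∀ {k} (I J M L : Label k) → conserve I J M L ≡ true →
                  size I ℕ.+ size J ≡ size M ℕ.+ size L
  conserve-size I J M L c with ≡-dec ℕ._≟_ (zipWith ℕ._+_ (toNat I) (toNat J))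
                                            (zipWith ℕ._+_ (toNat M) (toNat L))
  ... | yes eq = ≡.trans (≡.sym (sum-zipWith-+ (toNat I) (toNat J)))
                   (≡.trans (≡.cong Vec.sum eq) (sum-zipWith-+ (toNat M) (toNat L)))
  conserve-size I J M L () | no _

  -- Identities between exponents hold only where the guard does. Offering vanishing as the
  -- alternative lets sums be rewritten term by term without deciding equality in the ring.
  if-support : ∀ b d v → (b ≡ true × d ≡ true) ⊎ (if b ∧ d then v else 0#) ≈ 0#
  if-support false d     v = inj₂ refl
  if-support true  false v = inj₂ refl
  if-support true  true  v = inj₁ (≡.refl , ≡.refl)

  white-support : ∀ {k} t x (I J M L : Label k) →
                  size I ℕ.+ size J ≡ size M ℕ.+ size L ⊎ white t x I J M L ≈ 0#
  white-support t x I J M L with if-support (conserve I J M L) (noDouble I J) _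
  ... | inj₁ (c , _) = inj₁ (conserve-size I J M L c)
  ... | inj₂ z       = inj₂ z

  purple-support : ∀ {k} t y (I J M L : Label k) →
                   (size I ℕ.+ size J ≡ size M ℕ.+ size L × size M ≡ excess M J ℕ.+ size J)
                   ⊎ purple t y I J M L ≈ 0#
  purple-support t y I J M L with if-support (conserve I J M L) (dominates M J) _
  ... | inj₁ (c , d) = inj₁ (conserve-size I J M L c , dominates-size M J d)
  ... | inj₂ z       = inj₂ z

  -- Distributing a label over two edges

  -- Common form of `split` and `union`. `P` is evaluated at the number of later colours in S, which
  -- is what φ(A,S) asks of a colour in A.
  glue : (ℕ → Carrier) → Carrier → ∀ {k} → Label k → Label k → Label k → Carrier
  glue P q []      []      []      = 1#
  glue P q (s ∷ S) (a ∷ A) (b ∷ B) = glue₁ s a b (P (size S)) q * glue P q S A B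

  glue-support : ∀ P q {k} (S A B : Label k) →
                 size A ℕ.+ size B ≡ size S ⊎ glue P q S A B ≈ 0#
  glue-support P q []      []      []      = inj₁ ≡.refl
  glue-support P q (s ∷ S) (a ∷ A) (b ∷ B) with glue-support P q S A B
  ... | inj₂ z  = inj₂ (trans (*-congˡ z) (zeroʳ _))
  ... | inj₁ eq = go s a b
    where
    go : ∀ s a b → size (a ∷ A) ℕ.+ size (b ∷ B) ≡ size (s ∷ S)
                   ⊎ glue P q (s ∷ S) (a ∷ A) (b ∷ B) ≈ 0#
    go false false false = inj₁ eq
    go false false true  = inj₂ (zeroˡ _)
    go false true  false = inj₂ (zeroˡ _)
    go false true  true  = inj₂ (zeroˡ _)
    go true  false false = inj₂ (zeroˡ _)
    go true  false true  = inj₁ (≡.trans (ℕ.+-suc _ _) (≡.cong suc eq))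
    go true  true  false = inj₁ (≡.cong suc eq)
    go true  true  true  = inj₂ (zeroˡ _)

  -- φ-weighted distributions of S between a white and a purple horizontal edge:
  -- x^|A| y^|B| t^φ(A,S) if A + B = S, and 0 otherwise.
  split : Carrier → Carrier → Carrier → ∀ {k} → Label k → Label k → Label k → Carrier
  split t x y = glue (λ n → x * pow t n) y

  union : ∀ {k} → Label k → Label k → Label k → Carrier
  union = glue (λ _ → 1#) 1#

  sum₁-cong : {f g : Bool → Carrier} → (∀ b → f b ≈ g b) → sum₁ f ≈ sum₁ g
  sum₁-cong eq = +-cong (eq false) (eq true)

  sum₁-*ʳ : ∀ f c → sum₁ (λ a → f a * c) ≈ sum₁ f * c
  sum₁-*ʳ f c = sym (distribʳ c (f false) (f true))

  sum₃-cong : {f g : Bool → Bool → Bool → Carrier} →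
              (∀ a b m → f a b m ≈ g a b m) → sum₃ f ≈ sum₃ g
  sum₃-cong eq = sum₁-cong (λ a → sum₁-cong (λ b → sum₁-cong (eq a b)))

  sum₃-*ʳ : ∀ f c → sum₃ (λ a b m → f a b m * c) ≈ sum₃ f * c
  sum₃-*ʳ f c = trans
    (sum₁-cong {λ a → sum₁ (λ b → sum₁ (λ m → f a b m * c))} (λ a → trans
      (sum₁-cong {λ b → sum₁ (λ m → f a b m * c)} (λ b → sum₁-*ʳ (f a b) c))
      (sum₁-*ʳ (λ b → sum₁ (f a b)) c)))
    (sum₁-*ʳ (λ a → sum₁ (λ b → sum₁ (f a b))) c)

  ΣL³ : ∀ {k} → (Label k → Label k → Label k → Carrier) → Carrier
  ΣL³ f = ΣL (λ A → ΣL (λ B → ΣL (λ M → f A B M)))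

  ΣL³-cong : ∀ {k} {f g : Label k → Label k → Label k → Carrier} →
             (∀ A B M → f A B M ≈ g A B M) → ΣL³ f ≈ ΣL³ g
  ΣL³-cong eq = ΣL-cong (λ A → ΣL-cong (λ B → ΣL-cong (eq A B)))

  ΣL³-*ˡ : ∀ {k} c (f : Label k → Label k → Label k → Carrier) →
           ΣL³ (λ A B M → c * f A B M) ≈ c * ΣL³ f
  ΣL³-*ˡ c f = trans
    (ΣL-cong (λ A → trans (ΣL-cong (λ B → ΣL-*ˡ c _)) (ΣL-*ˡ c _))) (ΣL-*ˡ c _)

  ΣL³-+ : ∀ {k} (f g : Label k → Label k → Label k → Carrier) →
          ΣL³ (λ A B M → f A B M + g A B M) ≈ ΣL³ f + ΣL³ g
  ΣL³-+ f g = trans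
    (ΣL-cong (λ A → trans (ΣL-cong (λ B → ΣL-+ _ _)) (ΣL-+ _ _))) (ΣL-+ _ _)

  ΣL³-[] : (f : Label 0 → Label 0 → Label 0 → Carrier) → ΣL³ f ≈ f [] [] []
  ΣL³-[] f = trans (ΣL-[] _) (trans (ΣL-[] _) (ΣL-[] _))

  sum₁-ΣL : ∀ {k} (f : Bool → Label k → Carrier) →
            sum₁ (λ b → ΣL (f b)) ≈ ΣL (λ L → sum₁ (λ b → f b L))
  sum₁-ΣL f = sym (ΣL-+ (f false) (f true))

  ΣL³-suc : ∀ {k} (f : Label (suc k) → Label (suc k) → Label (suc k) → Carrier) →
            ΣL³ f ≈ ΣL³ (λ A B M → sum₃ (λ a b m → f (a ∷ A) (b ∷ B) (m ∷ M)))
  ΣL³-suc f = trans (ΣL-suc _) (ΣL-cong (λ A → begin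
    sum₁ (λ a → ΣL (λ B → ΣL (λ M → f (a ∷ A) B M)))
      ≈⟨ sum₁-cong {λ a → ΣL (λ B → ΣL (λ M → f (a ∷ A) B M))} (λ a → trans (ΣL-suc _)
           (ΣL-cong (λ B → trans (sum₁-cong {λ b → ΣL (f (a ∷ A) (b ∷ B))} (λ b → ΣL-suc _))
             (sum₁-ΣL (λ b M → sum₁ (λ m → f (a ∷ A) (b ∷ B) (m ∷ M))))))) ⟩
    sum₁ (λ a → ΣL (λ B → ΣL (λ M → sum₁ (λ b → sum₁ (λ m → f (a ∷ A) (b ∷ B) (m ∷ M))))))
      ≈⟨ trans
           (sum₁-ΣL (λ a B → ΣL (λ M → sum₁ (λ b → sum₁ (λ m → f (a ∷ A) (b ∷ B) (m ∷ M))))))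
           (ΣL-cong (λ B → sum₁-ΣL (λ a M → sum₁ (λ b → sum₁ (λ m → f (a ∷ A) (b ∷ B) (m ∷ M)))))) ⟩
    ΣL (λ B → ΣL (λ M → sum₃ (λ a b m → f (a ∷ A) (b ∷ B) (m ∷ M)))) ∎))

  white₁-cong : ∀ i j m l {z z'} → z ≈ z' → white₁ i j m l z ≈ white₁ i j m l z'
  white₁-cong false false false false eq = refl
  white₁-cong false false false true  eq = refl
  white₁-cong false false true  l     eq = refl
  white₁-cong false true  false false eq = refl
  white₁-cong false true  false true  eq = eq
  white₁-cong false true  true  false eq = refl
  white₁-cong false true  true  true  eq = refl
  white₁-cong true  false false false eq = refl
  white₁-cong true  false false true  eq = eq
  white₁-cong true  false true  false eq = refl
  white₁-cong true  false true  true  eq = refl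
  white₁-cong true  true  m     l     eq = refl

  -- Fusing a white and a purple vertex

  module Fusion (t x y : Carrier) where

    -- j counts the preceding colours on the right edge: each colour that leaves the
    -- purple vertex at the top without entering it from the left contributes t^j.
    fusedWP fusedPW : ℕ → ∀ {k} → VertexWeight k
    fusedWP j []      []      []      []        = 1#
    fusedWP j (i ∷ I) (s ∷ S) (m ∷ M) (s' ∷ S') =
      fusedWP₁ i s m s' (x * pow t (size S)) y (pow t j) * fusedWP (b2n s' ℕ.+ j) I S M S'
    fusedPW j []      []      []      []        = 1#
    fusedPW j (i ∷ I) (s ∷ S) (m ∷ M) (s' ∷ S') =
      fusedPW₁ i s m s' (x * pow t (size S)) y (pow t j) * fusedPW (b2n s' ℕ.+ j) I S M S'

    -- This is how j grows: the factor t^e released by a colour on the right edge is absorbed into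
    -- the excess power of the later colours.
    pow-scale : ∀ s' j e → scale₁ s' (pow t e) * pow (pow t j) e ≈ pow (pow t (b2n s' ℕ.+ j)) e
    pow-scale false j e = *-identityˡ _
    pow-scale true  j e = sym (pow-* t (pow t j) e)

    pow-excess-∷ : ∀ {n} T k b (K B : Label n) →
                   pow T (excess (k ∷ K) (b ∷ B)) ≈ excess₁ k b T * pow T (excess K B)
    pow-excess-∷ T false false K B = sym (*-identityˡ _)
    pow-excess-∷ T false true  K B = sym (*-identityˡ _)
    pow-excess-∷ T true  false K B = refl
    pow-excess-∷ T true  true  K B = sym (*-identityˡ _)

    glue-∷ : ∀ {n} P q s a b (S A B : Label n) →
             glue P q (s ∷ S) (a ∷ A) (b ∷ B) ≈ glue₁ s a b (P (size S)) q * glue P q S A B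
    glue-∷ P q s a b S A B = refl

    module _ {k : ℕ} where

      -- The excess power collects the factors left by j earlier colours on the right edge. It
      -- depends on the summed label B, so it has to stay inside the sum; at `j = 0` it is 1.
      wpWeight : ℕ → (I S K A' B' A B M : Label k) → Carrier
      wpWeight j I S K A' B' A B M =
        pow (pow t j) (excess K B) *
        (split t x y S A B * (white t x I A M A' * purple t y M B K B'))

      pwWeight : ℕ → (I K A B S' A' B' M : Label k) → Carrier
      pwWeight j I K A B S' A' B' M =
        pow (pow t j) (excess M B) *
        ((purple t y I B M B' * white t x M A K A') * union S' A' B')

      -- Conservation at both vertices and K ≥ B eliminate |M|. The white exponent is thereby split
      -- into a part fixed by the outgoing labels and the excess.
      wpWeight-support : ∀ j I S K A' B' A B M →
        size I ℕ.+ size A ≡ size A' ℕ.+ size B' ℕ.+ excess K B ⊎ wpWeight j I S K A' B' A B M ≈ 0#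
      wpWeight-support j I S K A' B' A B M
        with white-support t x I A M A' | purple-support t y M B K B'
      ... | inj₂ z | _ = inj₂ (trans
        (*-congˡ (trans (*-congˡ (trans (*-congʳ z) (zeroˡ _))) (zeroʳ _))) (zeroʳ _))
      ... | inj₁ _ | inj₂ z = inj₂ (trans
        (*-congˡ (trans (*-congˡ (trans (*-congˡ z) (zeroʳ _))) (zeroʳ _))) (zeroʳ _))
      ... | inj₁ IA | inj₁ (MB , KB) = inj₁ (≡.trans IA
        (≡.trans (≡.cong (ℕ._+ size A') M≡) (arith₂ (excess K B) (size B') (size A'))))
        where
        arith₁ : ∀ e b b' → e ℕ.+ b ℕ.+ b' ≡ e ℕ.+ b' ℕ.+ b
        arith₁ = solve-∀
        arith₂ : ∀ e b a → e ℕ.+ b ℕ.+ a ≡ a ℕ.+ b ℕ.+ e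
        arith₂ = solve-∀
        M≡ : size M ≡ excess K B ℕ.+ size B'
        M≡ = ℕ.+-cancelʳ-≡ (size B) _ _
          (≡.trans MB (≡.trans (≡.cong (ℕ._+ size B') KB) (arith₁ (excess K B) (size B) (size B'))))

      -- With the purple vertex below, M ≥ B gives |M| directly, and the fixed part of the white
      -- exponent consists of the incoming labels.
      pwWeight-support : ∀ j I K A B S' A' B' M →
        size M ℕ.+ size A ≡ size A ℕ.+ size B ℕ.+ excess M B ⊎ pwWeight j I K A B S' A' B' M ≈ 0#
      pwWeight-support j I K A B S' A' B' M with purple-support t y I B M B'
      ... | inj₂ z = inj₂ (trans
        (*-congˡ (trans (*-congʳ (trans (*-congʳ z) (zeroˡ _))) (zeroˡ _))) (zeroʳ _))
      ... | inj₁ (_ , MB) = inj₁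
        (≡.trans (≡.cong (ℕ._+ size A) MB) (arith (excess M B) (size B) (size A)))
        where
        arith : ∀ e b a → e ℕ.+ b ℕ.+ a ≡ a ℕ.+ b ℕ.+ e
        arith = solve-∀

      regroup-weight : ∀ {e e₁ e₂ f f₁ f₂ g g₁ g₂ h h₁ h₂ : Carrier} →
        e ≈ e₁ * e₂ → f ≈ f₁ * f₂ → g ≈ g₁ * g₂ → h ≈ h₁ * h₂ →
        e * (f * (g * h)) ≈ (e₁ * (f₁ * (g₁ * h₁))) * (e₂ * (f₂ * (g₂ * h₂)))
      regroup-weight p q r s = trans (*-cong p (*-cong q (*-cong r s)))
        (solve 8 (λ e₁ e₂ f₁ f₂ g₁ g₂ h₁ h₂ →
           (e₁ :* e₂) :* ((f₁ :* f₂) :* ((g₁ :* g₂) :* (h₁ :* h₂))) :=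
           (e₁ :* (f₁ :* (g₁ :* h₁))) :* (e₂ :* (f₂ :* (g₂ :* h₂)))) refl _ _ _ _ _ _ _ _)

      regroup-weight′ : ∀ {e e₁ e₂ f f₁ f₂ g g₁ g₂ h h₁ h₂ : Carrier} →
        e ≈ e₁ * e₂ → f ≈ f₁ * f₂ → g ≈ g₁ * g₂ → h ≈ h₁ * h₂ →
        e * ((f * g) * h) ≈ (e₁ * ((f₁ * g₁) * h₁)) * (e₂ * ((f₂ * g₂) * h₂))
      regroup-weight′ p q r s = trans (*-cong p (*-cong (*-cong q r) s))
        (solve 8 (λ e₁ e₂ f₁ f₂ g₁ g₂ h₁ h₂ →
           (e₁ :* e₂) :* (((f₁ :* f₂) :* (g₁ :* g₂)) :* (h₁ :* h₂)) :=
           (e₁ :* ((f₁ :* g₁) :* h₁)) :* (e₂ :* ((f₂ :* g₂) :* h₂))) refl _ _ _ _ _ _ _ _)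

      spectral : ∀ {m n e} → m ≡ n ℕ.+ e → x * pow t m ≈ (x * pow t n) * pow t e
      spectral {n = n} {e} ≡.refl = trans (*-congˡ (pow-+ t n e)) (sym (*-assoc _ _ _))

      wpWeight-∷ : ∀ j i s k' a' b' I S K A' B' A B M →
        let p = x * pow t (size S) ; X = x * pow t (size A' ℕ.+ size B')
            head = λ s' → fusedWP₁ i s k' s' p y (pow t j) * glue₁ s' a' b' X y
        in
        sum₃ (λ a b m →
          pow (pow t j) (excess (k' ∷ K) (b ∷ B)) *
          (split t x y (s ∷ S) (a ∷ A) (b ∷ B) *
           (white t x (i ∷ I) (a ∷ A) (m ∷ M) (a' ∷ A') *
            purple t y (m ∷ M) (b ∷ B) (k' ∷ K) (b' ∷ B')))) ≈
        head false * wpWeight j I S K A' B' A B M + head true * wpWeight (suc j) I S K A' B' A B M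
      wpWeight-∷ j i s k' a' b' I S K A' B' A B M = begin
        _ ≈⟨ sum₃-cong (λ a b m → regroup-weight (pow-excess-∷ (pow t j) k' b K B)
               (glue-∷ (λ n → x * pow t n) y s a b S A B)
               (white-∷ t x i a m a' I A M A') (purple-∷ t y m b k' b' M B K B')) ⟩
        sum₃ (λ a b m → term (x * pow t (size I ℕ.+ size A)) a b m * τ j)
          ≈⟨ sum₃-*ʳ (term (x * pow t (size I ℕ.+ size A))) (τ j) ⟩
        sum₃ (term (x * pow t (size I ℕ.+ size A))) * τ j
          -- Off the support the tail weight `τ j` is zero, so the parameter of the first colour may
          -- be changed there as well.
          ≈⟨ onSupport (wpWeight-support j I S K A' B' A B M) ⟩
        sum₃ (term (X * Z)) * τ j
          ≈⟨ *-congʳ (wp₁ i s k' a' b' p y (pow t j) X Z) ⟩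
        (head false * 1# + head true * Z) * τ j
          ≈⟨ solve 4 (λ f g z w → (f :* con 1 :+ g :* z) :* w := f :* w :+ g :* (z :* w)) refl _ _ _ _ ⟩
        head false * τ j + head true * (Z * τ j)
          ≈⟨ +-congˡ (*-congˡ (trans (sym (*-assoc _ _ _)) (*-congʳ (pow-scale true j (excess K B))))) ⟩
        head false * τ j + head true * τ (suc j) ∎
        where
        p = x * pow t (size S)
        X = x * pow t (size A' ℕ.+ size B')
        Z = pow t (excess K B)
        τ = λ j → wpWeight j I S K A' B' A B M
        head = λ s' → fusedWP₁ i s k' s' p y (pow t j) * glue₁ s' a' b' X y
        term = λ z → wpTerm i s k' a' b' p y (pow t j) z (y * Z)
        onSupport : size I ℕ.+ size A ≡ size A' ℕ.+ size B' ℕ.+ excess K B ⊎ τ j ≈ 0# →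
                    sum₃ (term (x * pow t (size I ℕ.+ size A))) * τ j ≈ sum₃ (term (X * Z)) * τ j
        onSupport (inj₁ eq) = *-congʳ (sum₃-cong
          {term (x * pow t (size I ℕ.+ size A))} {term (X * Z)} (λ a b m →
          *-congˡ (*-congˡ (*-congʳ (white₁-cong i a m a' (spectral {n = size A' ℕ.+ size B'} eq))))))
        onSupport (inj₂ z)  = trans (*-congˡ z) (trans (zeroʳ _) (sym (trans (*-congˡ z) (zeroʳ _))))

      pwWeight-∷ : ∀ j i k' a b s' I K A B S' A' B' M →
        let X = x * pow t (size A ℕ.+ size B) in
        sum₃ (λ a' b' m →
          pow (pow t j) (excess (m ∷ M) (b ∷ B)) *
          ((purple t y (i ∷ I) (b ∷ B) (m ∷ M) (b' ∷ B') *
            white t x (m ∷ M) (a ∷ A) (k' ∷ K) (a' ∷ A')) *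
           union (s' ∷ S') (a' ∷ A') (b' ∷ B'))) ≈
        sum₁ (λ s → glue₁ s a b 1# 1# * fusedPW₁ i s k' s' X y (pow t j)) *
        pwWeight (b2n s' ℕ.+ j) I K A B S' A' B' M
      pwWeight-∷ j i k' a b s' I K A B S' A' B' M = begin
        _ ≈⟨ sum₃-cong (λ a' b' m → regroup-weight′ (pow-excess-∷ (pow t j) m b M B)
               (purple-∷ t y i b m b' I B M B') (white-∷ t x m a k' a' M A K A')
               (glue-∷ (λ _ → 1#) 1# s' a' b' S' A' B')) ⟩
        sum₃ (λ a' b' m → term (x * pow t (size M ℕ.+ size A)) a' b' m * τ j)
          ≈⟨ sum₃-*ʳ (term (x * pow t (size M ℕ.+ size A))) (τ j) ⟩
        sum₃ (term (x * pow t (size M ℕ.+ size A))) * τ j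
          ≈⟨ onSupport (pwWeight-support j I K A B S' A' B' M) ⟩
        sum₃ (term (X * Z)) * τ j
          ≈⟨ *-congʳ (pw₁ i k' a b s' y (pow t j) X Z) ⟩
        (head * scale₁ s' Z) * τ j
          ≈⟨ *-assoc _ _ _ ⟩
        head * (scale₁ s' Z * τ j)
          ≈⟨ *-congˡ (trans (sym (*-assoc _ _ _)) (*-congʳ (pow-scale s' j (excess M B)))) ⟩
        head * τ (b2n s' ℕ.+ j) ∎
        where
        X = x * pow t (size A ℕ.+ size B)
        Z = pow t (excess M B)
        τ = λ j → pwWeight j I K A B S' A' B' M
        head = sum₁ (λ s → glue₁ s a b 1# 1# * fusedPW₁ i s k' s' X y (pow t j))
        term = λ z → pwTerm i k' a b s' (pow t j) z (y * Z)
        onSupport : size M ℕ.+ size A ≡ size A ℕ.+ size B ℕ.+ excess M B ⊎ τ j ≈ 0# →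
                    sum₃ (term (x * pow t (size M ℕ.+ size A))) * τ j ≈ sum₃ (term (X * Z)) * τ j
        onSupport (inj₁ eq) = *-congʳ (sum₃-cong
          {term (x * pow t (size M ℕ.+ size A))} {term (X * Z)} (λ a' b' m →
          *-congˡ (*-congʳ (*-congˡ (white₁-cong m a k' a' (spectral {n = size A ℕ.+ size B} eq))))))
        onSupport (inj₂ z)  = trans (*-congˡ z) (trans (zeroʳ _) (sym (trans (*-congˡ z) (zeroʳ _))))

    glue₁-cong : ∀ s a b {p p' q} → p ≈ p' → glue₁ s a b p q ≈ glue₁ s a b p' q
    glue₁-cong false false false eq = refl
    glue₁-cong false false true  eq = refl
    glue₁-cong false true  b     eq = refl
    glue₁-cong true  false false eq = refl
    glue₁-cong true  false true  eq = refl
    glue₁-cong true  true  false eq = eq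
    glue₁-cong true  true  true  eq = refl

    fusedPW₁-cong : ∀ i s k s' {p p' q T} → p ≈ p' → fusedPW₁ i s k s' p q T ≈ fusedPW₁ i s k s' p' q T
    fusedPW₁-cong false false false false eq = refl
    fusedPW₁-cong false false false true  eq = refl
    fusedPW₁-cong false false true  s'    eq = refl
    fusedPW₁-cong false true  false false eq = refl
    fusedPW₁-cong false true  false true  eq = eq
    fusedPW₁-cong false true  true  false eq = refl
    fusedPW₁-cong false true  true  true  eq = refl
    fusedPW₁-cong true  false false false eq = refl
    fusedPW₁-cong true  false false true  eq = +-congʳ (*-congʳ eq)
    fusedPW₁-cong true  false true  false eq = refl
    fusedPW₁-cong true  false true  true  eq = refl
    fusedPW₁-cong true  true  false s'    eq = refl
    fusedPW₁-cong true  true  true  false eq = refl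
    fusedPW₁-cong true  true  true  true  eq = refl

    -- The weighted splitting is carried through a column from its left edge to its right edge. The
    -- induction over colours needs all j at once, because the term with s' = 1 calls it at `suc j`.
    white-purple-local : ∀ {k} j (I S K A' B' : Label k) →
      ΣL³ (wpWeight j I S K A' B') ≈ ΣL (λ S' → fusedWP j I S K S' * split t x y S' A' B')
    white-purple-local j [] [] [] [] [] = trans (ΣL³-[] _) (trans
      (solve 0 (con 1 :* (con 1 :* ((con 1 :* con 1) :* (con 1 :* con 1))) := con 1 :* con 1) refl)
      (sym (ΣL-[] _)))
    white-purple-local j (i ∷ I) (s ∷ S) (k' ∷ K) (a' ∷ A') (b' ∷ B') = begin
      _ ≈⟨ ΣL³-suc _ ⟩
      _ ≈⟨ ΣL³-cong (wpWeight-∷ j i s k' a' b' I S K A' B') ⟩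
      ΣL³ (λ A B M → head false * wpWeight j I S K A' B' A B M +
                     head true * wpWeight (suc j) I S K A' B' A B M)
        ≈⟨ trans (ΣL³-+ _ _) (+-cong (ΣL³-*ˡ _ _) (ΣL³-*ˡ _ _)) ⟩
      head false * ΣL³ (wpWeight j I S K A' B') + head true * ΣL³ (wpWeight (suc j) I S K A' B')
        ≈⟨ +-cong (*-congˡ (white-purple-local j I S K A' B'))
                  (*-congˡ (white-purple-local (suc j) I S K A' B')) ⟩
      _ ≈⟨ trans (ΣL-+ _ _) (+-cong (ΣL-*ˡ _ _) (ΣL-*ˡ _ _)) ⟨
      ΣL (λ S' → sum₁ (λ s' → head s' * (fusedWP (b2n s' ℕ.+ j) I S K S' * split t x y S' A' B')))
        -- `X` contains |A'| + |B'| where `split` expects |S'|; these agree wherever `split` is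
        -- nonzero.
        ≈⟨ ΣL-cong (λ S' → sum₁-cong (λ s' → onSupport s' S' (glue-support (λ n → x * pow t n) y S' A' B'))) ⟩
      _ ≈⟨ ΣL-suc _ ⟨
      ΣL (λ S' → fusedWP j (i ∷ I) (s ∷ S) (k' ∷ K) S' * split t x y S' (a' ∷ A') (b' ∷ B')) ∎
      where
      p = x * pow t (size S)
      X = x * pow t (size A' ℕ.+ size B')
      head = λ s' → fusedWP₁ i s k' s' p y (pow t j) * glue₁ s' a' b' X y
      onSupport : ∀ s' S' → size A' ℕ.+ size B' ≡ size S' ⊎ split t x y S' A' B' ≈ 0# →
        head s' * (fusedWP (b2n s' ℕ.+ j) I S K S' * split t x y S' A' B') ≈
        fusedWP j (i ∷ I) (s ∷ S) (k' ∷ K) (s' ∷ S') * split t x y (s' ∷ S') (a' ∷ A') (b' ∷ B')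
      onSupport s' S' (inj₁ eq) = trans
        (*-congʳ (*-congˡ (glue₁-cong s' a' b' (reflexive (≡.cong (λ n → x * pow t n) eq)))))
        (solve 4 (λ a b c d → (a :* b) :* (c :* d) := (a :* c) :* (b :* d)) refl _ _ _ _)
      onSupport s' S' (inj₂ z) = trans (*-congˡ (trans (*-congˡ z) (zeroʳ _))) (trans (zeroʳ _)
        (sym (trans (*-congˡ (trans (*-congˡ z) (zeroʳ _))) (zeroʳ _))))

    -- The mirror relation: `union` is carried from the right edge of a column to its left edge. As
    -- s' is given, a single value of j continues the induction.
    purple-white-local : ∀ {k} j (I K A B S' : Label k) →
      ΣL³ (pwWeight j I K A B S') ≈ ΣL (λ S → union S A B * fusedPW j I S K S')
    purple-white-local j [] [] [] [] [] = trans (ΣL³-[] _) (trans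
      (solve 0 (con 1 :* (((con 1 :* con 1) :* (con 1 :* con 1)) :* con 1) := con 1 :* con 1) refl)
      (sym (ΣL-[] _)))
    purple-white-local j (i ∷ I) (k' ∷ K) (a ∷ A) (b ∷ B) (s' ∷ S') = begin
      _ ≈⟨ ΣL³-suc _ ⟩
      _ ≈⟨ ΣL³-cong (pwWeight-∷ j i k' a b s' I K A B S') ⟩
      ΣL³ (λ A' B' M → sum₁ head * pwWeight (b2n s' ℕ.+ j) I K A B S' A' B' M)
        ≈⟨ ΣL³-*ˡ _ _ ⟩
      sum₁ head * ΣL³ (pwWeight (b2n s' ℕ.+ j) I K A B S')
        ≈⟨ *-congˡ (purple-white-local (b2n s' ℕ.+ j) I K A B S') ⟩
      sum₁ head * ΣL (λ S → union S A B * fusedPW (b2n s' ℕ.+ j) I S K S')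
        ≈⟨ ΣL-*ˡ _ _ ⟨
      ΣL (λ S → sum₁ head * (union S A B * fusedPW (b2n s' ℕ.+ j) I S K S'))
        ≈⟨ ΣL-cong (λ S → trans (distribʳ _ _ _)
             (sum₁-cong (λ s → onSupport s S (glue-support (λ _ → 1#) 1# S A B)))) ⟩
      _ ≈⟨ ΣL-suc _ ⟨
      ΣL (λ S → union S (a ∷ A) (b ∷ B) * fusedPW j (i ∷ I) S (k' ∷ K) (s' ∷ S')) ∎
      where
      X = x * pow t (size A ℕ.+ size B)
      head = λ s → glue₁ s a b 1# 1# * fusedPW₁ i s k' s' X y (pow t j)
      onSupport : ∀ s S → size A ℕ.+ size B ≡ size S ⊎ union S A B ≈ 0# →
        head s * (union S A B * fusedPW (b2n s' ℕ.+ j) I S K S') ≈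
        union (s ∷ S) (a ∷ A) (b ∷ B) * fusedPW j (i ∷ I) (s ∷ S) (k' ∷ K) (s' ∷ S')
      onSupport s S (inj₁ eq) = trans
        (*-congʳ (*-congˡ (fusedPW₁-cong i s k' s' (reflexive (≡.cong (λ n → x * pow t n) eq)))))
        (solve 4 (λ a b c d → (a :* b) :* (c :* d) := (a :* c) :* (b :* d)) refl _ _ _ _)
      onSupport s S (inj₂ z) = trans (*-congˡ (trans (*-congʳ z) (zeroˡ _))) (trans (zeroʳ _)
        (sym (trans (*-congʳ (trans (*-congˡ z) (zeroʳ _))) (zeroˡ _))))

    -- The gauge factor between the two fused vertices

    gauge : ℕ → Carrier
    gauge zero    = 1#
    gauge (suc m) = gauge m * (x * pow t m + y)

    -- Part-way through the colours, |S| + j counts a mixed edge: earlier colours from S', later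
    -- ones from S. Treating one colour changes this count by s' - s, and the resulting ratio x
    -- t^(|S| + j) + y is the weight of leaving for `fusedWP₁` and of entering for `fusedPW₁`.
    fused-gauge : ∀ {k} j (I S K S' : Label k) →
      fusedWP j I S K S' * gauge (size S' ℕ.+ j) ≈ gauge (size S ℕ.+ j) * fusedPW j I S K S'
    fused-gauge j [] [] [] [] = *-comm _ _
    fused-gauge j (i ∷ I) (s ∷ S) (k' ∷ K) (s' ∷ S') = begin
      (wp * fusedWP j' I S K S') * gauge (b2n s' ℕ.+ size S' ℕ.+ j)
        ≈⟨ *-congˡ (reflexive (≡.cong gauge (arith (b2n s') (size S') j))) ⟩
      (wp * fusedWP j' I S K S') * gauge (size S' ℕ.+ j')
        ≈⟨ trans (*-assoc _ _ _) (*-congˡ (fused-gauge j' I S K S')) ⟩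
      wp * (gauge (size S ℕ.+ j') * fusedPW j' I S K S')
        ≈⟨ *-assoc _ _ _ ⟨
      (wp * gauge (size S ℕ.+ j')) * fusedPW j' I S K S'
        ≈⟨ *-congʳ (trans (*-congˡ (reflexive (≡.cong gauge (≡.sym (arith (b2n s') (size S) j))))) (go i s k' s')) ⟩
      (gauge (b2n s ℕ.+ size S ℕ.+ j) * pw) * fusedPW j' I S K S'
        ≈⟨ *-assoc _ _ _ ⟩
      gauge (b2n s ℕ.+ size S ℕ.+ j) * (pw * fusedPW j' I S K S') ∎
      where
      j' = b2n s' ℕ.+ j
      p = x * pow t (size S)
      wp = fusedWP₁ i s k' s' p y (pow t j)
      pw = fusedPW₁ i s k' s' p y (pow t j)
      arith : ∀ a b c → a ℕ.+ b ℕ.+ c ≡ b ℕ.+ (a ℕ.+ c)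
      arith = solve-∀
      D : p * pow t j + y ≈ x * pow t (size S ℕ.+ j) + y
      D = +-congʳ (trans (*-assoc _ _ _) (*-congˡ (sym (pow-+ t (size S) j))))
      go : ∀ i s k' s' →
           fusedWP₁ i s k' s' p y (pow t j) * gauge (b2n s' ℕ.+ size S ℕ.+ j) ≈
           gauge (b2n s ℕ.+ size S ℕ.+ j) * fusedPW₁ i s k' s' p y (pow t j)
      vanish : ∀ {a b} → 0# * a ≈ b * 0#
      vanish = trans (zeroˡ _) (sym (zeroʳ _))
      go false false false false = *-comm _ _
      go false false false true  = vanish
      go false false true  s'    = vanish
      go false true  false false = vanish
      go false true  false true  = *-comm _ _
      go false true  true  false = trans (*-comm _ _) (trans (*-congˡ D) (sym (*-identityʳ _)))
      go false true  true  true  = vanish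
      go true  false false false = vanish
      go true  false false true  = trans (*-identityˡ _) (*-congˡ (sym D))
      go true  false true  false = *-comm _ _
      go true  false true  true  = vanish
      go true  true  false s'    = vanish
      go true  true  true  false = vanish
      go true  true  true  true  = *-comm _ _

  -- Fusing two rows

  ∅ : ∀ {k} → Label k
  ∅ = emptyLabel

  glue-∅∅ : ∀ P q {k} (S : Label k) → glue P q S ∅ ∅ ≈ [ labelEq S ∅ ]
  glue-∅∅ P q []          = refl
  glue-∅∅ P q (false ∷ S) = trans (*-identityˡ _) (glue-∅∅ P q S)
  glue-∅∅ P q (true  ∷ S) = zeroˡ _

  ∅-glue : ∀ P q {k} (A B : Label k) → glue P q ∅ A B ≈ [ labelEq A ∅ ] * [ labelEq B ∅ ]
  ∅-glue P q []          []          = sym (*-identityˡ _)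
  ∅-glue P q (false ∷ A) (false ∷ B) = trans (*-identityˡ _) (∅-glue P q A B)
  ∅-glue P q (false ∷ A) (true  ∷ B) = trans (zeroˡ _) (sym (zeroʳ _))
  ∅-glue P q (true  ∷ A) (false ∷ B) = trans (zeroˡ _) (sym (zeroˡ _))
  ∅-glue P q (true  ∷ A) (true  ∷ B) = trans (zeroˡ _) (sym (zeroˡ _))

  ΣL² : ∀ {k} → (Label k → Label k → Carrier) → Carrier
  ΣL² f = ΣL (λ A → ΣL (f A))

  ΣL²-cong : ∀ {k} {f g : Label k → Label k → Carrier} → (∀ A B → f A B ≈ g A B) → ΣL² f ≈ ΣL² g
  ΣL²-cong eq = ΣL-cong (λ A → ΣL-cong (eq A))

  ΣL²-*ˡ : ∀ {k} c (f : Label k → Label k → Carrier) → ΣL² (λ A B → c * f A B) ≈ c * ΣL² f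
  ΣL²-*ˡ c f = trans (ΣL-cong (λ A → ΣL-*ˡ c _)) (ΣL-*ˡ c _)

  ΣL²-ΣL : ∀ {k k'} (f : Label k → Label k → Label k' → Carrier) →
           ΣL² (λ A B → ΣL (f A B)) ≈ ΣL (λ C → ΣL² (λ A B → f A B C))
  ΣL²-ΣL f = trans (ΣL-cong (λ A → ΣL-swap _)) (ΣL-swap _)

  ΣL²-swap : ∀ {k k'} (f : Label k → Label k → Label k' → Label k' → Carrier) →
             ΣL² (λ A B → ΣL² (f A B)) ≈ ΣL² (λ C D → ΣL² (λ A B → f A B C D))
  ΣL²-swap f = trans (ΣL²-ΣL _) (ΣL-cong (λ C → ΣL²-ΣL _))

  ΣL³-*ʳ : ∀ {k} c (f : Label k → Label k → Label k → Carrier) →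
           ΣL³ (λ A B M → f A B M * c) ≈ ΣL³ f * c
  ΣL³-*ʳ c f = trans (ΣL³-cong (λ A B M → *-comm _ c)) (trans (ΣL³-*ˡ c f) (*-comm c _))

  ΣL²-δ : ∀ {k} (f : Label k → Label k → Carrier) →
          ΣL² (λ A B → ([ labelEq A ∅ ] * [ labelEq B ∅ ]) * f A B) ≈ f ∅ ∅
  ΣL²-δ f = trans
    (ΣL-cong (λ A → trans (ΣL-cong (λ B → *-assoc _ _ _))
      (trans (ΣL-*ˡ _ _) (*-congˡ (ΣL-δ ∅ (f A))))))
    (ΣL-δ ∅ (λ A → f A ∅))

  double : ∀ {k w} → (v₁ v₂ : VertexWeight k) → Label k → Label k →
           Vec (Label k) w → Vec (Label k) w → Carrier
  double v₁ v₂ A B Is Ks = ΣR (λ Ms → rowZ v₁ A Is Ms * rowZ v₂ B Ms Ks)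

  rowZ-∷ : ∀ {k w} (v : VertexWeight k) J I K (Is Ks : Vec (Label k) w) →
           rowZ v J (I ∷ Is) (K ∷ Ks) ≈ ΣL (λ L → v I J K L * rowZ v L Is Ks)
  rowZ-∷ v J I K Is Ks = reflexive (ΣL-def _)

  double-[] : ∀ {k} (v₁ v₂ : VertexWeight k) A B →
              double v₁ v₂ A B [] [] ≈ [ labelEq A ∅ ] * [ labelEq B ∅ ]
  double-[] v₁ v₂ A B = ΣR-[] _

  double-∷ : ∀ {k w} (v₁ v₂ : VertexWeight k) A B I K (Is Ks : Vec (Label k) w) →
    double v₁ v₂ A B (I ∷ Is) (K ∷ Ks) ≈
    ΣL² (λ A' B' → ΣL (λ M → v₁ I A M A' * v₂ M B K B') * double v₁ v₂ A' B' Is Ks)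
  double-∷ v₁ v₂ A B I K Is Ks = begin
    double v₁ v₂ A B (I ∷ Is) (K ∷ Ks)
      ≈⟨ trans (ΣR-suc _) (ΣR-ΣL _) ⟩
    ΣL (λ M → ΣR (λ r → rowZ v₁ A (I ∷ Is) (M ∷ r) * rowZ v₂ B (M ∷ r) (K ∷ Ks)))
      ≈⟨ ΣL-cong (λ M → ΣR-cong (λ r → trans
           (*-cong (rowZ-∷ v₁ A I M Is r) (rowZ-∷ v₂ B M K r Ks)) (ΣL-*-ΣL _ _))) ⟩
    ΣL (λ M → ΣR (λ r → ΣL² (λ A' B' → (v₁ I A M A' * rowZ v₁ A' Is r) *
                                       (v₂ M B K B' * rowZ v₂ B' r Ks))))
      ≈⟨ ΣL-cong (λ M → trans (ΣR-ΣL _) (ΣL-cong (λ A' → ΣR-ΣL _))) ⟩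
    ΣL (λ M → ΣL² (λ A' B' → ΣR (λ r → (v₁ I A M A' * rowZ v₁ A' Is r) *
                                       (v₂ M B K B' * rowZ v₂ B' r Ks))))
      ≈⟨ ΣL-cong (λ M → ΣL²-cong (λ A' B' → trans
           (ΣR-cong (λ r → solve 4 (λ a b c d → (a :* b) :* (c :* d) := (a :* c) :* (b :* d))
             refl _ _ _ _))
           (ΣR-*ˡ _ _))) ⟩
    ΣL (λ M → ΣL² (λ A' B' → (v₁ I A M A' * v₂ M B K B') * double v₁ v₂ A' B' Is Ks))
      ≈⟨ ΣL²-ΣL _ ⟨
    ΣL² (λ A' B' → ΣL (λ M → (v₁ I A M A' * v₂ M B K B') * double v₁ v₂ A' B' Is Ks))
      ≈⟨ ΣL²-cong (λ A' B' → ΣL-*ʳ _ _) ⟩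
    ΣL² (λ A' B' → ΣL (λ M → v₁ I A M A' * v₂ M B K B') * double v₁ v₂ A' B' Is Ks) ∎

  module Rows (t x y : Carrier) where
    open Fusion t x y

    -- Inserts the excess factor at `j = 0`, where its base `pow t 0` is 1.
    pow-1-* : ∀ n {z} → pow 1# n * z ≈ z
    pow-1-* n = trans (*-congʳ (pow-1 n)) (*-identityˡ _)

    -- Each column passes the splitting on to the next one; at the empty right boundary only S = ∅
    -- survives, with weight 1.
    split-row : ∀ {k w} S (Is Ks : Vec (Label k) w) →
      ΣL² (λ A B → split t x y S A B * double (white t x) (purple t y) A B Is Ks) ≈
      rowZ (fusedWP 0) S Is Ks
    split-row S [] [] = begin
      ΣL² (λ A B → split t x y S A B * double (white t x) (purple t y) A B [] [])
        ≈⟨ ΣL²-cong (λ A B → trans (*-congˡ (double-[] (white t x) (purple t y) A B)) (*-comm _ _)) ⟩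
      ΣL² (λ A B → ([ labelEq A ∅ ] * [ labelEq B ∅ ]) * split t x y S A B)
        ≈⟨ ΣL²-δ _ ⟩
      split t x y S ∅ ∅
        ≈⟨ glue-∅∅ _ y S ⟩
      [ labelEq S ∅ ] ∎
    split-row S (I ∷ Is) (K ∷ Ks) = begin
      ΣL² (λ A B → split t x y S A B * double W P A B (I ∷ Is) (K ∷ Ks))
        ≈⟨ ΣL²-cong (λ A B → trans (*-congˡ (double-∷ W P A B I K Is Ks)) (sym (ΣL²-*ˡ _ _))) ⟩
      ΣL² (λ A B → ΣL² (λ A' B' → split t x y S A B *
        (ΣL (λ M → W I A M A' * P M B K B') * double W P A' B' Is Ks)))
        ≈⟨ ΣL²-swap _ ⟩
      ΣL² (λ A' B' → ΣL² (λ A B → split t x y S A B *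
        (ΣL (λ M → W I A M A' * P M B K B') * double W P A' B' Is Ks)))
        ≈⟨ ΣL²-cong (λ A' B' → trans
             (ΣL²-cong (λ A B → trans (sym (*-assoc _ _ _)) (trans (*-congʳ
               (trans (sym (ΣL-*ˡ _ _)) (ΣL-cong (λ M → sym (pow-1-* (excess K B))))))
               (sym (ΣL-*ʳ _ _)))))
             (ΣL³-*ʳ _ (wpWeight 0 I S K A' B'))) ⟩
      ΣL² (λ A' B' → ΣL³ (wpWeight 0 I S K A' B') * double W P A' B' Is Ks)
        ≈⟨ ΣL²-cong (λ A' B' → trans (*-congʳ (white-purple-local 0 I S K A' B'))
             (trans (sym (ΣL-*ʳ _ _)) (ΣL-cong (λ S' → *-assoc _ _ _)))) ⟩
      ΣL² (λ A' B' → ΣL (λ S' → fusedWP 0 I S K S' *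
        (split t x y S' A' B' * double W P A' B' Is Ks)))
        ≈⟨ trans (ΣL²-ΣL _) (ΣL-cong (λ S' → ΣL²-*ˡ _ _)) ⟩
      ΣL (λ S' → fusedWP 0 I S K S' *
        ΣL² (λ A' B' → split t x y S' A' B' * double W P A' B' Is Ks))
        ≈⟨ ΣL-cong (λ S' → *-congˡ (split-row S' Is Ks)) ⟩
      ΣL (λ S' → fusedWP 0 I S K S' * rowZ (fusedWP 0) S' Is Ks)
        ≈⟨ rowZ-∷ (fusedWP 0) S I K Is Ks ⟨
      rowZ (fusedWP 0) S (I ∷ Is) (K ∷ Ks) ∎
      where
      W = white t x
      P = purple t y

    -- The empty right boundary is a union of empty labels, and each column moves this property one
    -- step to the left. If A and B share a colour, every `union S A B` is zero and so is the double
    -- row.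
    union-row : ∀ {k w} A B (Is Ks : Vec (Label k) w) →
      double (purple t y) (white t x) B A Is Ks ≈
      ΣL (λ S → union S A B * rowZ (fusedPW 0) S Is Ks)
    union-row A B [] [] = begin
      double (purple t y) (white t x) B A [] []
        ≈⟨ trans (double-[] (purple t y) (white t x) B A) (*-comm _ _) ⟩
      [ labelEq A ∅ ] * [ labelEq B ∅ ]
        ≈⟨ ∅-glue _ 1# A B ⟨
      union ∅ A B
        ≈⟨ ΣL-δ ∅ (λ S → union S A B) ⟨
      ΣL (λ S → [ labelEq S ∅ ] * union S A B)
        ≈⟨ ΣL-cong (λ S → *-comm _ _) ⟩
      ΣL (λ S → union S A B * [ labelEq S ∅ ]) ∎
    union-row A B (I ∷ Is) (K ∷ Ks) = begin
      double P W B A (I ∷ Is) (K ∷ Ks)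
        -- The lower row is purple, so its edge B' is the outer summation variable until the swap.
        ≈⟨ trans (double-∷ P W B A I K Is Ks) (ΣL-swap _) ⟩
      ΣL² (λ A' B' → ΣL (λ M → P I B M B' * W M A K A') * double P W B' A' Is Ks)
        ≈⟨ ΣL²-cong (λ A' B' → trans (*-congˡ (union-row A' B' Is Ks)) (sym (ΣL-*ˡ _ _))) ⟩
      ΣL² (λ A' B' → ΣL (λ S' → ΣL (λ M → P I B M B' * W M A K A') *
        (union S' A' B' * rowZ (fusedPW 0) S' Is Ks)))
        ≈⟨ ΣL²-ΣL _ ⟩
      ΣL (λ S' → ΣL² (λ A' B' → ΣL (λ M → P I B M B' * W M A K A') *
        (union S' A' B' * rowZ (fusedPW 0) S' Is Ks)))
        ≈⟨ ΣL-cong (λ S' → trans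
             (ΣL²-cong (λ A' B' → trans (sym (*-assoc _ _ _)) (trans (*-congʳ
               (trans (sym (ΣL-*ʳ _ _)) (ΣL-cong (λ M → sym (pow-1-* (excess M B))))))
               (sym (ΣL-*ʳ _ _)))))
             (ΣL³-*ʳ _ (pwWeight 0 I K A B S'))) ⟩
      ΣL (λ S' → ΣL³ (pwWeight 0 I K A B S') * rowZ (fusedPW 0) S' Is Ks)
        ≈⟨ ΣL-cong (λ S' → trans (*-congʳ (purple-white-local 0 I K A B S'))
             (trans (sym (ΣL-*ʳ _ _)) (ΣL-cong (λ S → *-assoc _ _ _)))) ⟩
      ΣL (λ S' → ΣL (λ S → union S A B * (fusedPW 0 I S K S' * rowZ (fusedPW 0) S' Is Ks)))
        ≈⟨ trans (ΣL-swap _) (ΣL-cong (λ S → ΣL-*ˡ _ _)) ⟩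
      ΣL (λ S → union S A B * ΣL (λ S' → fusedPW 0 I S K S' * rowZ (fusedPW 0) S' Is Ks))
        ≈⟨ ΣL-cong (λ S → *-congˡ (sym (rowZ-∷ (fusedPW 0) S I K Is Ks))) ⟩
      ΣL (λ S → union S A B * rowZ (fusedPW 0) S (I ∷ Is) (K ∷ Ks)) ∎
      where
      W = white t x
      P = purple t y

    gauge-∅ : ∀ {k} (S : Label k) → [ labelEq S ∅ ] ≈ gauge (size S) * [ labelEq S ∅ ]
    gauge-∅ []          = sym (*-identityˡ _)
    gauge-∅ (false ∷ S) = gauge-∅ S
    gauge-∅ (true  ∷ S) = sym (zeroʳ _)

    -- The gauge factors telescope along the row: each column trades that of its right edge for that
    -- of its left edge, and the empty right boundary contributes 1.
    row-gauge : ∀ {k w} S (Is Ks : Vec (Label k) w) →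
      rowZ (fusedWP 0) S Is Ks ≈ gauge (size S) * rowZ (fusedPW 0) S Is Ks
    row-gauge S [] [] = gauge-∅ S
    row-gauge S (I ∷ Is) (K ∷ Ks) = begin
      rowZ (fusedWP 0) S (I ∷ Is) (K ∷ Ks)
        ≈⟨ rowZ-∷ (fusedWP 0) S I K Is Ks ⟩
      ΣL (λ S' → fusedWP 0 I S K S' * rowZ (fusedWP 0) S' Is Ks)
        ≈⟨ ΣL-cong (λ S' → trans (*-congˡ (row-gauge S' Is Ks)) (trans (sym (*-assoc _ _ _))
             (trans (*-congʳ (local S')) (*-assoc _ _ _)))) ⟩
      ΣL (λ S' → gauge (size S) * (fusedPW 0 I S K S' * rowZ (fusedPW 0) S' Is Ks))
        ≈⟨ trans (ΣL-*ˡ _ _) (*-congˡ (sym (rowZ-∷ (fusedPW 0) S I K Is Ks))) ⟩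
      gauge (size S) * rowZ (fusedPW 0) S (I ∷ Is) (K ∷ Ks) ∎
      where
      local : ∀ S' → fusedWP 0 I S K S' * gauge (size S') ≈ gauge (size S) * fusedPW 0 I S K S'
      local S' = ≡.subst₂ (λ a b → fusedWP 0 I S K S' * gauge a ≈ gauge b * fusedPW 0 I S K S')
        (ℕ.+-identityʳ (size S')) (ℕ.+-identityʳ (size S)) (fused-gauge 0 I S K S')

    row-gauge-∅ : ∀ {k w} (Is Ks : Vec (Label k) w) →
      rowZ (fusedWP 0) ∅ Is Ks ≈ rowZ (fusedPW 0) ∅ Is Ks
    row-gauge-∅ {k} Is Ks = trans (row-gauge ∅ Is Ks)
      (trans (*-congʳ (reflexive (≡.cong gauge (size-∅ k)))) (*-identityˡ _))
      where
      size-∅ : ∀ k → size (∅ {k}) ≡ 0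
      size-∅ zero    = ≡.refl
      size-∅ (suc k) = size-∅ k

    white-purple-row : ∀ {k w} (Is Ks : Vec (Label k) w) →
      double (white t x) (purple t y) ∅ ∅ Is Ks ≈ rowZ (fusedPW 0) ∅ Is Ks
    white-purple-row Is Ks = begin
      double (white t x) (purple t y) ∅ ∅ Is Ks
        ≈⟨ ΣL²-δ (λ A B → double (white t x) (purple t y) A B Is Ks) ⟨
      ΣL² (λ A B → ([ labelEq A ∅ ] * [ labelEq B ∅ ]) * double (white t x) (purple t y) A B Is Ks)
        ≈⟨ ΣL²-cong (λ A B → *-congʳ (∅-glue _ y A B)) ⟨
      ΣL² (λ A B → split t x y ∅ A B * double (white t x) (purple t y) A B Is Ks)
        ≈⟨ split-row ∅ Is Ks ⟩
      rowZ (fusedWP 0) ∅ Is Ks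
        ≈⟨ row-gauge-∅ Is Ks ⟩
      rowZ (fusedPW 0) ∅ Is Ks ∎

    purple-white-row : ∀ {k w} (Is Ks : Vec (Label k) w) →
      double (purple t y) (white t x) ∅ ∅ Is Ks ≈ rowZ (fusedPW 0) ∅ Is Ks
    purple-white-row Is Ks = begin
      double (purple t y) (white t x) ∅ ∅ Is Ks
        ≈⟨ union-row ∅ ∅ Is Ks ⟩
      ΣL (λ S → union S ∅ ∅ * rowZ (fusedPW 0) S Is Ks)
        ≈⟨ ΣL-cong (λ S → *-congʳ (glue-∅∅ _ 1# S)) ⟩
      ΣL (λ S → [ labelEq S ∅ ] * rowZ (fusedPW 0) S Is Ks)
        ≈⟨ ΣL-δ ∅ _ ⟩
      rowZ (fusedPW 0) ∅ Is Ks ∎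

    -- Opposite parameters

    module _ (x+y≈0 : x + y ≈ 0#) where

      -- The factor at i = 0 is x + y, and every nonempty product contains it.
      gauge-vanishes : ∀ m → gauge (suc m) ≈ 0#
      gauge-vanishes zero    = trans (*-identityˡ _) (trans (+-congʳ (*-identityʳ x)) x+y≈0)
      gauge-vanishes (suc m) = trans (*-congʳ (gauge-vanishes m)) (zeroˡ _)

      gauge-δ : ∀ {k} (S : Label k) → gauge (size S) ≈ [ labelEq S ∅ ]
      gauge-δ []          = refl
      gauge-δ (false ∷ S) = gauge-δ S
      gauge-δ (true  ∷ S) = gauge-vanishes (size S)

      -- With empty horizontal edges j stays 0, so a vertical path weighs t^0.
      fusedWP-∅∅ : ∀ {k} (I K : Label k) → fusedWP 0 I ∅ K ∅ ≈ [ labelEq I K ]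
      fusedWP-∅∅ []          []          = refl
      fusedWP-∅∅ (false ∷ I) (false ∷ K) = trans (*-identityˡ _) (fusedWP-∅∅ I K)
      fusedWP-∅∅ (false ∷ I) (true  ∷ K) = zeroˡ _
      fusedWP-∅∅ (true  ∷ I) (false ∷ K) = zeroˡ _
      fusedWP-∅∅ (true  ∷ I) (true  ∷ K) = trans (*-identityˡ _) (fusedWP-∅∅ I K)

      fusedPW-row : ∀ {k w} (Is Ks : Vec (Label k) w) →
        rowZ (fusedPW 0) ∅ Is Ks ≈ [ rowEq Is Ks ]
      fusedPW-row {k} [] [] = reflexive (≡.cong [_] (∅≡∅ k))
        where
        ∅≡∅ : ∀ k → labelEq (∅ {k}) ∅ ≡ true
        ∅≡∅ zero    = ≡.refl
        ∅≡∅ (suc k) = ∅≡∅ k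
      fusedPW-row (I ∷ Is) (K ∷ Ks) = begin
        rowZ (fusedPW 0) ∅ (I ∷ Is) (K ∷ Ks)
          -- Using `fusedWP` in this column and returning to `fusedPW` in the tail leaves
          -- `gauge (size S)` on the edge between them, which forces S to be empty.
          ≈⟨ row-gauge-∅ (I ∷ Is) (K ∷ Ks) ⟨
        rowZ (fusedWP 0) ∅ (I ∷ Is) (K ∷ Ks)
          ≈⟨ rowZ-∷ (fusedWP 0) ∅ I K Is Ks ⟩
        ΣL (λ S → fusedWP 0 I ∅ K S * rowZ (fusedWP 0) S Is Ks)
          ≈⟨ ΣL-cong (λ S → trans
               (*-congˡ (trans (row-gauge S Is Ks) (*-congʳ (gauge-δ S))))
               (solve 3 (λ a b c → a :* (b :* c) := b :* (a :* c)) refl _ _ _)) ⟩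
        ΣL (λ S → [ labelEq S ∅ ] * (fusedWP 0 I ∅ K S * rowZ (fusedPW 0) S Is Ks))
          ≈⟨ ΣL-δ ∅ (λ S → fusedWP 0 I ∅ K S * rowZ (fusedPW 0) S Is Ks) ⟩
        fusedWP 0 I ∅ K ∅ * rowZ (fusedPW 0) ∅ Is Ks
          ≈⟨ *-cong (fusedWP-∅∅ I K) (fusedPW-row Is Ks) ⟩
        [ labelEq I K ] * [ rowEq Is Ks ]
          ≈⟨ []-∧ (labelEq I K) (rowEq Is Ks) ⟨
        [ rowEq (I ∷ Is) (K ∷ Ks) ] ∎

  -- Commutation relations between rows

  infix 4 _≋_

  -- Equality of transfer matrices. Quantifying over both boundary rows makes it a congruence for
  -- stacking; being a record, it lets unification recover the lists of rows.
  record _≋_ {k} (vs us : List (VertexWeight k)) : Set (c ⊔ ℓ) where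
    constructor equivalent
    field latZ-≈ : ∀ {w} (B T : Vec (Label k) w) → latZ vs B T ≈ latZ us B T

  open _≋_ public

  ≋-refl : ∀ {k} {vs : List (VertexWeight k)} → vs ≋ vs
  ≋-refl = equivalent λ B T → refl

  ≋-sym : ∀ {k} {vs us : List (VertexWeight k)} → vs ≋ us → us ≋ vs
  ≋-sym e = equivalent λ B T → sym (latZ-≈ e B T)

  ≋-trans : ∀ {k} {vs us ws : List (VertexWeight k)} → vs ≋ us → us ≋ ws → vs ≋ ws
  ≋-trans e f = equivalent λ B T → trans (latZ-≈ e B T) (latZ-≈ f B T)

  latZ-∷ : ∀ {k w} (v : VertexWeight k) vs (B T : Vec (Label k) w) →
           latZ (v ∷ vs) B T ≈ ΣR (λ M → rowZ v ∅ B M * latZ vs M T)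
  latZ-∷ v vs B T = reflexive (ΣR-def _)

  latZ-++ : ∀ {k w} (vs us : List (VertexWeight k)) (B T : Vec (Label k) w) →
            latZ (vs ++ us) B T ≈ ΣR (λ M → latZ vs B M * latZ us M T)
  latZ-++ []       us B T = sym (ΣR-δ B (λ M → latZ us M T))
  latZ-++ (v ∷ vs) us B T = begin
    latZ (v ∷ vs ++ us) B T
      ≈⟨ latZ-∷ v (vs ++ us) B T ⟩
    ΣR (λ M → rowZ v ∅ B M * latZ (vs ++ us) M T)
      ≈⟨ ΣR-cong (λ M → trans (*-congˡ (latZ-++ vs us M T)) (trans (sym (ΣR-*ˡ _ _))
           (ΣR-cong (λ M' → sym (*-assoc _ _ _))))) ⟩
    ΣR (λ M → ΣR (λ M' → (rowZ v ∅ B M * latZ vs M M') * latZ us M' T))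
      ≈⟨ trans (ΣR-swap _) (ΣR-cong (λ M' → ΣR-*ʳ _ _)) ⟩
    ΣR (λ M' → ΣR (λ M → rowZ v ∅ B M * latZ vs M M') * latZ us M' T)
      ≈⟨ ΣR-cong (λ M' → *-congʳ (latZ-∷ v vs B M')) ⟨
    ΣR (λ M' → latZ (v ∷ vs) B M' * latZ us M' T) ∎

  ++-cong-≋ : ∀ {k} {vs vs' us us' : List (VertexWeight k)} →
              vs ≋ vs' → us ≋ us' → vs ++ us ≋ vs' ++ us'
  ++-cong-≋ {vs = vs} {vs'} {us} {us'} e f = equivalent λ B T → trans (latZ-++ vs us B T)
    (trans (ΣR-cong (λ M → *-cong (latZ-≈ e B M) (latZ-≈ f M T))) (sym (latZ-++ vs' us' B T)))

  rowEq-sym : ∀ {k w} (A B : Vec (Label k) w) → rowEq A B ≡ rowEq B A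
  rowEq-sym []      []      = ≡.refl
  rowEq-sym (a ∷ A) (b ∷ B) = ≡.cong₂ _∧_ (labelEq-sym a b) (rowEq-sym A B)

  latZ-double : ∀ {k w} (v₁ v₂ : VertexWeight k) (B T : Vec (Label k) w) →
                latZ (v₁ ∷ v₂ ∷ []) B T ≈ double v₁ v₂ ∅ ∅ B T
  latZ-double v₁ v₂ B T = trans (latZ-∷ v₁ (v₂ ∷ []) B T)
    (ΣR-cong (λ M → *-congˡ (trans (latZ-∷ v₂ [] M T) (trans
      (ΣR-cong (λ M' → trans (*-congˡ (reflexive (≡.cong [_] (rowEq-sym M' T)))) (*-comm _ _)))
      (ΣR-δ T (λ M' → rowZ v₂ ∅ M M'))))))

  -- a b = a b (a⁻¹ a) = a (b a⁻¹) a = a (a⁻¹ b) a = (a a⁻¹) b a = b a.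
  inverse-commute : ∀ {k} {a a⁻¹ b : VertexWeight k} →
    a ∷ a⁻¹ ∷ [] ≋ [] → a⁻¹ ∷ a ∷ [] ≋ [] → b ∷ a⁻¹ ∷ [] ≋ a⁻¹ ∷ b ∷ [] →
    a ∷ b ∷ [] ≋ b ∷ a ∷ []
  inverse-commute {a = a} {a⁻¹} {b} aa⁻¹ a⁻¹a ba⁻¹ =
    ≋-trans (++-cong-≋ {vs = a ∷ b ∷ []} ≋-refl (≋-sym a⁻¹a))
    (≋-trans (++-cong-≋ {vs = a ∷ []} ≋-refl (++-cong-≋ {us = a ∷ []} ba⁻¹ ≋-refl))
      (++-cong-≋ {us = b ∷ a ∷ []} aa⁻¹ ≋-refl))

  module _ {k : ℕ} (t : Carrier) where

    white-purple-comm : ∀ x y → white {k} t x ∷ purple t y ∷ [] ≋ purple t y ∷ white t x ∷ []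
    white-purple-comm x y = equivalent λ B T → begin
      latZ (white t x ∷ purple t y ∷ []) B T ≈⟨ latZ-double (white t x) (purple t y) B T ⟩
      double (white t x) (purple t y) ∅ ∅ B T ≈⟨ Rows.white-purple-row t x y B T ⟩
      rowZ (Fusion.fusedPW t x y 0) ∅ B T ≈⟨ Rows.purple-white-row t x y B T ⟨
      double (purple t y) (white t x) ∅ ∅ B T ≈⟨ latZ-double (purple t y) (white t x) B T ⟨
      latZ (purple t y ∷ white t x ∷ []) B T ∎

    white-purple-cancel : ∀ {x y} → x + y ≈ 0# → white {k} t x ∷ purple t y ∷ [] ≋ []
    white-purple-cancel {x} {y} x+y≈0 = equivalent λ B T → trans (latZ-double (white t x) (purple t y) B T)
      (trans (Rows.white-purple-row t x y B T) (Rows.fusedPW-row t x y x+y≈0 B T))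

    purple-white-cancel : ∀ {x y} → x + y ≈ 0# → purple {k} t y ∷ white t x ∷ [] ≋ []
    purple-white-cancel {x} {y} x+y≈0 = ≋-trans
      (≋-sym (white-purple-comm x y)) (white-purple-cancel x+y≈0)

    white-comm : ∀ x x' → white {k} t x ∷ white t x' ∷ [] ≋ white t x' ∷ white t x ∷ []
    white-comm x x' = inverse-commute {a⁻¹ = purple t (- x)}
      (white-purple-cancel (-‿inverseʳ x)) (purple-white-cancel (-‿inverseʳ x))
      (white-purple-comm x' (- x))

    purple-comm : ∀ y y' → purple {k} t y ∷ purple t y' ∷ [] ≋ purple t y' ∷ purple t y ∷ []
    purple-comm y y' = inverse-commute {a⁻¹ = white t (- y)}
      (purple-white-cancel (-‿inverseˡ y)) (white-purple-cancel (-‿inverseˡ y))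
      (≋-sym (white-purple-comm (- y) y'))

  ↭⇒≋ : ∀ {k} (v : Carrier → VertexWeight k) →
        (∀ x x' → v x ∷ v x' ∷ [] ≋ v x' ∷ v x ∷ []) →
        ∀ {xs ys} → xs ↭ ys → List.map v xs ≋ List.map v ys
  ↭⇒≋ v comm _↭_.refl = ≋-refl
  ↭⇒≋ v comm (prep x p) = ++-cong-≋ {vs = v x ∷ []} ≋-refl (↭⇒≋ v comm p)
  ↭⇒≋ v comm (_↭_.swap x x' p) =
    ++-cong-≋ (comm x x') (↭⇒≋ v comm p)
  ↭⇒≋ v comm (_↭_.trans p q) =
    ≋-trans (↭⇒≋ v comm p) (↭⇒≋ v comm q)

-- Supersymmetry of the partition functions

theorem4p7 : ∀ {c ℓ} (R : CommutativeRing c ℓ) (k : ℕ) (lam mu : Vec Partition k) (ℓ' N : ℕ)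
    → (∀ a → len (lookup lam a) ≤ ℓ') → (∀ a → len (lookup mu a) ≤ ℓ')
    → (∀ a → part (lookup lam a) 1 ≤ N) → (∀ a → part (lookup mu a) 1 ≤ N)
    → (t : CommutativeRing.Carrier R)
    → ((n m : ℕ) (xs : Vec (CommutativeRing.Carrier R) n) (ys : Vec (CommutativeRing.Carrier R) m) (σ : Permutation′ n)
    → CommutativeRing._≈_ R (Lattice.LS R t lam mu ℓ' N (tabulate (λ i → lookup xs (σ ⟨$⟩ʳ i))) ys)
    (Lattice.LS R t lam mu ℓ' N xs ys))
    × ((n m : ℕ) (xs : Vec (CommutativeRing.Carrier R) n) (ys : Vec (CommutativeRing.Carrier R) m) (σ : Permutation′ m)
    → CommutativeRing._≈_ R (Lattice.LS R t lam mu ℓ' N xs (tabulate (λ i → lookup ys (σ ⟨$⟩ʳ i))))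
    (Lattice.LS R t lam mu ℓ' N xs ys))
    × ((n m : ℕ) (xs : Vec (CommutativeRing.Carrier R) n) (ys : Vec (CommutativeRing.Carrier R) m) (r : CommutativeRing.Carrier R)
    → CommutativeRing._≈_ R (Lattice.LS R t lam mu ℓ' N (xs ∷ʳ r) (ys ∷ʳ CommutativeRing.-_ R r))
    (Lattice.LS R t lam mu ℓ' N xs ys))
theorem4p7 R k lam mu ℓ' N _ _ _ _ t = symmetricX , symmetricY , cancellation
  where
  open CommutativeRing R using (Carrier; _≈_; -_; -‿inverseʳ)
  open Lattice R
  open TransferMatrices R

  rows : List Carrier → List Carrier → List (VertexWeight k)
  rows xs ys = List.map (white t) xs ++ List.map (purple t) ys

  rows-↭ : ∀ {xs xs' ys ys'} → xs ↭ xs' → ys ↭ ys' → rows xs ys ≋ rows xs' ys'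
  rows-↭ p q = ++-cong-≋ (↭⇒≋ (white t) (white-comm t) p) (↭⇒≋ (purple t) (purple-comm t) q)

  LS-≋ : ∀ {n m n' m'} {xs : Vec Carrier n} {ys : Vec Carrier m}
           {xs' : Vec Carrier n'} {ys' : Vec Carrier m'} →
         rows (toList xs) (toList ys) ≋ rows (toList xs') (toList ys') →
         LS t lam mu ℓ' N xs ys ≈ LS t lam mu ℓ' N xs' ys'
  LS-≋ {xs = xs} {ys} {xs'} {ys'} e
    rewrite toList-map (white {k} t) xs | toList-map (purple {k} t) ys
          | toList-map (white {k} t) xs' | toList-map (purple {k} t) ys'
    = latZ-≈ e (boundary mu ℓ' N) (boundary lam ℓ' N)

  symmetricX : ∀ n m (xs : Vec Carrier n) (ys : Vec Carrier m) (σ : Permutation′ n) →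
    LS t lam mu ℓ' N (tabulate (λ i → lookup xs (σ ⟨$⟩ʳ i))) ys ≈ LS t lam mu ℓ' N xs ys
  symmetricX n m xs ys σ =
    LS-≋ {ys = ys} {xs} {ys} (rows-↭ (toList-permute xs σ) _↭_.refl)

  symmetricY : ∀ n m (xs : Vec Carrier n) (ys : Vec Carrier m) (σ : Permutation′ m) →
    LS t lam mu ℓ' N xs (tabulate (λ i → lookup ys (σ ⟨$⟩ʳ i))) ≈ LS t lam mu ℓ' N xs ys
  symmetricY n m xs ys σ =
    LS-≋ {xs = xs} {xs' = xs} {ys} (rows-↭ {toList xs} _↭_.refl (toList-permute ys σ))

  cancellation : ∀ n m (xs : Vec Carrier n) (ys : Vec Carrier m) r →
    LS t lam mu ℓ' N (xs ∷ʳ r) (ys ∷ʳ - r) ≈ LS t lam mu ℓ' N xs ys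
  cancellation n m xs ys r = LS-≋ {xs = xs ∷ʳ r} {ys ∷ʳ - r} {xs} {ys} (≋-trans
    -- The white row r is already the topmost white one. Moving - r to the bottom of the purple
    -- block makes the two adjacent, and reassociating the list exposes the pair.
    (rows-↭ (↭-reflexive (toList-∷ʳ r xs)) (toList-∷ʳ-↭ ys (- r)))
    (≡.subst (_≋ rows (toList xs) (toList ys))
      (≡.sym (≡.trans (≡.cong (_++ _) (map-++ (white t) (toList xs) (r ∷ [])))
                      (++-assoc (List.map (white t) (toList xs)) _ _)))
      (++-cong-≋ {vs = List.map (white t) (toList xs)} ≋-refl
        (++-cong-≋ (white-purple-cancel t (-‿inverseʳ r)) ≋-refl))))
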